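{- Let $G$ be a graph on $[n]$ that is upper crossing closed with respect to a total order $\unlhd$ on $E(G)$. Then for every $H\in NC_G$, $$\mu(H)=(-1)^{n-cc(H)}\,\mathrm{ncnbc}_{n-cc(H)}(H).$$ Moreover, if $NC_G$ is graded, then $$\chi(NC_G,t)=\sum_{k\ge 0}(-1)^k\,\mathrm{ncnbc}_k(G)\,t^{\rho(NC_G)-k}.$$
   Context: All graphs are finite simple graphs with vertex set $[n]=\{1,\dots,n\}$; edges are written $ij$ with $i<j$. Two edges $a_1a_2$ and $b_1b_2$ cross if $a_1<b_1<a_2<b_2$ or $b_1<a_1<b_2<a_2$. A spanning subgraph is identified with its edge set. A bond of $G$ is a spanning subgraph each of whose connected components is an induced subgraph of $G$; for a bond $H$, $\pi(H)$ is the partition of $[n]$ into the vertex sets of its components, and $cc(H)$ is its number of connected components. A set partition is crossing if there are distinct blocks $B,B'$ and $a,c\in B$, $b,d\in B'$ with $a<b<c<d$, noncrossing otherwise; $H$ is noncrossing if $\pi(H)$ is. $NC_G$ is the poset of noncrossing bonds ordered by inclusion of edge sets; its minimum is the empty bond $\hat0$. Two crossing edges $e,f$ are crossing closed if among all induced connected subgraphs of $G$ containing $e$ and $f$ there is a unique minimal one (under containment), denoted $J(e,f)$; $G$ is crossing closed if all pairs of crossing edges are. $G$ is upper crossing closed with respect to a total order $\unlhd$ on $E(G)$ if $G$ is crossing closed and for every pair of crossing edges $e,f$, $J(e,f)$ contains an edge $h$ with $h\lhd e$ and $h\lhd f$. Given a total order on the edges of a graph $X$, a broken circuit is the edge set of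 a cycle of $X$ with its smallest edge removed; an NBC set is a set of edges containing no broken circuit; a noncrossing NBC set is an NBC set no two of whose edges cross. $\mathrm{ncnbc}_k(X)$ is the number of noncrossing NBC sets of $X$ of size $k$ (for $H\in NC_G$, using the restriction of $\unlhd$ to $E(H)$). The Möbius function is $\mu(\hat0)=1$ and $\mu(x)=-\sum_{y<x}\mu(y)$ for $x\neq\hat0$. For graded $P$ with rank function $\rho$ and $\hat0$, $\chi(P,t)=\sum_{x\in P}\mu(x)t^{\rho(P)-\rho(x)}$, where $\rho(P)$ is the rank of $P$. -}

module Defs where

open import Data.Nat.Base as ℕ using (ℕ; zero; suc)
open import Data.Nat.Properties as ℕ using (anyUpTo?)
open import Data.Integer.Base as ℤ using (ℤ; +_; 0ℤ; 1ℤ)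
open import Data.Integer.Properties as ℤ using ()
open import Data.Fin.Base using (Fin; _<_)
open import Data.Fin.Properties using (_≟_; _<?_; any?; all?; injective⇒≤)
open import Data.Fin.Subset using (Subset; inside; outside; ⊥; _∈_; _⊆_; _⊂_; _∩_; _-_; ∣_∣)
open import Data.Fin.Subset.Properties using (_∈?_; _⊆?_; _⊂?_; anySubset?)
open import Data.Fin.Subset.Induction using (⊂-wellFounded)
open import Data.Bool.Base using (if_then_else_)
open import Data.Bool.Properties as Bool using ()
open import Data.Vec.Base as Vec using (Vec; []; _∷_)
open import Data.Vec.Properties as Vec using ()
open import Data.Vec.Relation.Unary.All as VecAll using ()
open import Data.Vec.Relation.Unary.Any as VecAny using ()
open import Data.Vec.Relation.Unary.AllPairs as VecAllPairs using ()
open import Data.Vec.Relation.Unary.Unique.Propositional using (Unique)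
open import Data.Vec.Relation.Unary.Unique.Propositional.Properties using (lookup-injective)
open import Data.List.Base as List using (List; []; _∷_; _++_; filter; length; deduplicate; allFin)
open import Data.List.Extrema.Nat using (max)
import Data.List.Membership.DecPropositional as DecMembership
import Data.List.Membership.Propositional as List
open import Data.List.Membership.Propositional.Properties using (∈-filter⁺; ∈-filter⁻; ∈-allFin)
open import Data.List.Relation.Unary.Any using (here; there)
open import Data.Product using (∃; ∃₂; ∃!; _×_; _,_; proj₁; proj₂)
open import Data.Sum.Base using (_⊎_; inj₁; inj₂)
open import Function.Base using (_∘_)
open import Induction.WellFounded using (module All)
open import Level using (Level; 0ℓ)
open import Relation.Binary.Consequences using (total∧dec⇒dec)
open import Relation.Binary.Construct.Closure.ReflexiveTransitive as Star using (Star; ε; _◅_; _◅◅_)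
import Relation.Binary.Construct.NonStrictToStrict as NonStrictToStrict
open import Relation.Binary.Core using (Rel)
open import Relation.Binary.Definitions as Binary using (DecidableEquality)
open import Relation.Binary.PropositionalEquality using (_≡_; _≢_; refl)
open import Relation.Binary.Structures using (IsTotalOrder)
open import Relation.Nullary using (¬_; Dec; does; yes; no)
open import Relation.Nullary.Decidable using (¬?; _×-dec_; _⊎-dec_; _→-dec_; map′)
open import Relation.Unary using (Pred; Decidable)

private
  variable
    a ℓ : Level
    A : Set a

∑ : List A → (A → ℤ) → ℤ
∑ xs f = List.foldr ℤ._+_ 0ℤ (List.map f xs)

-- f p if p proves A, and 0 if A is refuted.
[_⇒_] : Dec A → (A → ℤ) → ℤ
[ yes p ⇒ f ] = f p
[ no _  ⇒ f ] = 0ℤ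

infix 4 _≟ₛ_
_≟ₛ_ : ∀ {m} → DecidableEquality (Subset m)
_≟ₛ_ = Vec.≡-dec Bool._≟_

setOf : ∀ {m} {P : Pred (Fin m) ℓ} → Decidable P → Subset m
setOf P? = Vec.tabulate (does ∘ P?)

subsets : ∀ m → List (Subset m)
subsets zero    = [] ∷ []
subsets (suc m) = List.map (outside ∷_) (subsets m) ++ List.map (inside ∷_) (subsets m)

-- A Laurent polynomial in t with integer coefficients is given by its
-- coefficients: p j is the coefficient of t^j.  Allowing negative exponents
-- means that t^(r - k) needs no truncated subtraction.
Laurent : Set
Laurent = ℤ → ℤ

monomial : ℤ → ℤ → Laurent
monomial c e j = [ e ℤ.≟ j ⇒ (λ _ → c) ]

∑ᴸ : List A → (A → Laurent) → Laurent
∑ᴸ xs p j = ∑ xs (λ x → p x j)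

-- A family P of subsets of Fin m, regarded as a poset under inclusion.
-- Whenever this is used ⊥ belongs to P and so is the minimum 0̂.

module InclusionPoset {m} {P : Pred (Subset m) ℓ} (P? : Decidable P) where

  elements : List (Subset m)
  elements = filter P? (subsets m)

  -- μ(0̂) = 1 and μ(x) = - ∑_{y<x} μ(y); elements y that are not below x
  -- contribute the summand 0.
  μ-step : ∀ x → (∀ {y} → y ⊂ x → ℤ) → ℤ
  μ-step x μ-below = if does (x ≟ₛ ⊥)
    then 1ℤ
    else ℤ.- ∑ elements (λ y → [ y ⊂? x ⇒ μ-below ])

  μ : Subset m → ℤ
  μ = All.wfRec ⊂-wellFounded _ (λ _ → ℤ) μ-step

  Covers : Subset m → Subset m → Set ℓ
  Covers x y = P x × P y × x ⊂ y × ¬ ∃ λ z → P z × x ⊂ z × z ⊂ y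

  -- Only the values of ρ on elements of P matter.
  record IsRankFunction (ρ : Subset m → ℕ) : Set ℓ where
    field
      rank-0̂     : ρ ⊥ ≡ 0
      rank-cover : ∀ {x y} → Covers x y → ρ y ≡ suc (ρ x)

  record Graded : Set ℓ where
    field
      ρ              : Subset m → ℕ
      isRankFunction : IsRankFunction ρ

    rank : ℕ
    rank = max 0 (List.map ρ elements)

  χ : Graded → Laurent
  χ graded = ∑ᴸ elements λ x → monomial (μ x) (+ rank ℤ.- + ρ x)
    where open Graded graded

private
  Joined : List (A × A) → Rel A _
  Joined es u v = (u , v) List.∈ es ⊎ (v , u) List.∈ es

  module _ {A : Set a} {p q : A} {es : List (A × A)} where

    weaken : ∀ {u v} → Star (Joined es) u v → Star (Joined ((p , q) ∷ es)) u v
    weaken = Star.map λ where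
      (inj₁ i) → inj₁ (there i)
      (inj₂ i) → inj₂ (there i)

    Split : Rel A _
    Split u v = Star (Joined es) u v
              ⊎ Star (Joined es) u p × Star (Joined es) q v
              ⊎ Star (Joined es) u q × Star (Joined es) p v

    split⁻ : ∀ {u v} → Split u v → Star (Joined ((p , q) ∷ es)) u v
    split⁻ (inj₁ r)              = weaken r
    split⁻ (inj₂ (inj₁ (r , s))) = weaken r ◅◅ inj₁ (here refl) ◅ weaken s
    split⁻ (inj₂ (inj₂ (r , s))) = weaken r ◅◅ inj₂ (here refl) ◅ weaken s

    step : ∀ {u w v} → Joined es u w → Split w v → Split u v
    step s (inj₁ r)              = inj₁ (s ◅ r)
    step s (inj₂ (inj₁ (r , t))) = inj₂ (inj₁ (s ◅ r , t))
    step s (inj₂ (inj₂ (r , t))) = inj₂ (inj₂ (s ◅ r , t))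

    split⁺ : ∀ {u v} → Star (Joined ((p , q) ∷ es)) u v → Split u v
    split⁺ ε = inj₁ ε
    split⁺ (inj₁ (there i) ◅ r) = step (inj₁ i) (split⁺ r)
    split⁺ (inj₂ (there i) ◅ r) = step (inj₂ i) (split⁺ r)
    split⁺ (inj₁ (here refl) ◅ r) with split⁺ r
    ... | inj₁ t              = inj₂ (inj₁ (ε , t))
    ... | inj₂ (inj₁ (_ , t)) = inj₂ (inj₁ (ε , t))
    ... | inj₂ (inj₂ (_ , t)) = inj₁ t
    split⁺ (inj₂ (here refl) ◅ r) with split⁺ r
    ... | inj₁ t              = inj₂ (inj₂ (ε , t))
    ... | inj₂ (inj₁ (_ , t)) = inj₁ t
    ... | inj₂ (inj₂ (_ , t)) = inj₂ (inj₂ (ε , t))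

  reachable? : DecidableEquality A → ∀ es → Binary.Decidable (Star (Joined {A = A} es))
  reachable? _≟ᴬ_ [] u v = map′ (λ { refl → ε }) (λ { ε → refl ; (inj₁ () ◅ _) ; (inj₂ () ◅ _) }) (u ≟ᴬ v)
  reachable? _≟ᴬ_ ((p , q) ∷ es) u v = map′ split⁻ split⁺
    (r? u v ⊎-dec (r? u p ×-dec r? q v) ⊎-dec (r? u q ×-dec r? p v))
    where r? = reachable? _≟ᴬ_ es

  anyVec? : ∀ {n} k {P : Pred (Vec (Fin n) k) ℓ} → Decidable P → Dec (∃ P)
  anyVec? zero    P? = map′ (λ p → [] , p) (λ { ([] , p) → p }) (P? [])
  anyVec? (suc k) P? = map′ (λ { (x , xs , p) → x ∷ xs , p }) (λ { (x ∷ xs , p) → x , xs , p })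
    (any? λ x → anyVec? k (P? ∘ (x ∷_)))

-- A simple graph on [n] = Fin n.  The edges are indexed by Fin size; edge e is {lo e , hi e}.
record Graph (n : ℕ) : Set where
  field
    size   : ℕ
    lo hi  : Fin size → Fin n
    lo<hi  : ∀ e → lo e < hi e
    simple : ∀ {e f} → lo e ≡ lo f → hi e ≡ hi f → e ≡ f

  Edge : Set
  Edge = Fin size

  Spanning : Set
  Spanning = Subset size

module _ {n} (G : Graph n) where
  open Graph G

  Crosses : Rel Edge 0ℓ
  Crosses e f = (lo e < lo f × lo f < hi e × hi e < hi f)
              ⊎ (lo f < lo e × lo e < hi f × hi f < hi e)

  crosses? : Binary.Decidable Crosses
  crosses? e f = (lo e <? lo f ×-dec lo f <? hi e ×-dec hi e <? hi f)
           ⊎-dec (lo f <? lo e ×-dec lo e <? hi f ×-dec hi f <? hi e)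

  Joins : Edge → Rel (Fin n) 0ℓ
  Joins e u v = (lo e ≡ u × hi e ≡ v) ⊎ (lo e ≡ v × hi e ≡ u)

  joins? : ∀ e → Binary.Decidable (Joins e)
  joins? e u v = (lo e ≟ u ×-dec hi e ≟ v) ⊎-dec (lo e ≟ v ×-dec hi e ≟ u)

  Adjacent : Spanning → Rel (Fin n) 0ℓ
  Adjacent H u v = ∃ λ e → e ∈ H × Joins e u v

  adjacent? : ∀ H → Binary.Decidable (Adjacent H)
  adjacent? H u v = any? λ e → e ∈? H ×-dec joins? e u v

  Connected : Spanning → Rel (Fin n) 0ℓ
  Connected H = Star (Adjacent H)

  connected? : ∀ H → Binary.Decidable (Connected H)
  connected? H u v = map′ (Star.map to) (Star.map from) (reachable? _≟_ pairs u v)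
    where
    edges = filter (_∈? H) (allFin size)
    pairs = List.map (λ e → lo e , hi e) edges

    pick : ∀ {es u v} → (u , v) List.∈ List.map (λ e → lo e , hi e) es →
           ∃ λ e → e List.∈ es × lo e ≡ u × hi e ≡ v
    pick {e ∷ _} (here refl) = e , here refl , refl , refl
    pick {_ ∷ _} (there i) with pick i
    ... | e , j , p = e , there j , p

    put : ∀ {es e} → e List.∈ es → (lo e , hi e) List.∈ List.map (λ e → lo e , hi e) es
    put (here refl) = here refl
    put (there i)   = there (put i)

    to : ∀ {u v} → Joined pairs u v → Adjacent H u v
    to (inj₁ i) with pick i
    ... | e , j , p = e , proj₂ (∈-filter⁻ (_∈? H) {xs = allFin size} j) , inj₁ p
    to (inj₂ i) with pick i
    ... | e , j , p = e , proj₂ (∈-filter⁻ (_∈? H) {xs = allFin size} j) , inj₂ p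

    from : ∀ {u v} → Adjacent H u v → Joined pairs u v
    from (e , i , inj₁ (refl , refl)) = inj₁ (put (∈-filter⁺ (_∈? H) (∈-allFin e) i))
    from (e , i , inj₂ (refl , refl)) = inj₂ (put (∈-filter⁺ (_∈? H) (∈-allFin e) i))

  induced : Subset n → Spanning
  induced W = setOf λ e → lo e ∈? W ×-dec hi e ∈? W

  component : Spanning → Fin n → Subset n
  component H v = setOf (connected? H v)

  π : Spanning → List (Subset n)
  π H = deduplicate _≟ₛ_ (List.map (component H) (allFin n))

  cc : Spanning → ℕ
  cc H = length (π H)

  -- induced W is the edge set of G[W]; the component of H with vertex set W has edge set H ∩ induced W.
  IsBond : Pred Spanning 0ℓ
  IsBond H = ∀ v → H ∩ induced (component H v) ≡ induced (component H v)

  isBond? : Decidable IsBond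
  isBond? H = all? λ v → H ∩ induced (component H v) ≟ₛ induced (component H v)

  CrossingPartition : Pred (List (Subset n)) 0ℓ
  CrossingPartition 𝓑 = ∃₂ λ B B′ → B List.∈ 𝓑 × B′ List.∈ 𝓑 × B ≢ B′ ×
    (∃₂ λ a c → a ∈ B × c ∈ B ×
    (∃₂ λ b d → b ∈ B′ × d ∈ B′ × a < b × b < c × c < d))

  crossingPartition? : Decidable CrossingPartition
  crossingPartition? 𝓑 = anySubset? λ B → anySubset? λ B′ →
    B ∈ᴸ? 𝓑 ×-dec B′ ∈ᴸ? 𝓑 ×-dec ¬? (B ≟ₛ B′) ×-dec
    (any? λ a → any? λ c → a ∈? B ×-dec c ∈? B ×-dec
    (any? λ b → any? λ d → b ∈? B′ ×-dec d ∈? B′ ×-dec a <? b ×-dec b <? c ×-dec c <? d))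
    where open DecMembership (_≟ₛ_ {n}) renaming (_∈?_ to _∈ᴸ?_)

  NoncrossingBond : Pred Spanning 0ℓ
  NoncrossingBond H = IsBond H × ¬ CrossingPartition (π H)

  noncrossingBond? : Decidable NoncrossingBond
  noncrossingBond? H = isBond? H ×-dec ¬? (crossingPartition? (π H))

  module NC = InclusionPoset noncrossingBond?

  -- Induced subgraphs G[W] are identified with their vertex sets W; containment
  -- of induced subgraphs is then inclusion of vertex sets.
  ConnectedContaining : Edge → Edge → Pred (Subset n) 0ℓ
  ConnectedContaining e f W = e ∈ induced W × f ∈ induced W ×
    (∀ {u v} → u ∈ W → v ∈ W → Connected (induced W) u v)

  MinimalConnectedContaining : Edge → Edge → Pred (Subset n) 0ℓ
  MinimalConnectedContaining e f W = ConnectedContaining e f W ×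
    (∀ {W′} → ConnectedContaining e f W′ → W′ ⊆ W → W′ ≡ W)

  CrossingClosed : Set
  CrossingClosed = ∀ {e f} → Crosses e f → ∃! _≡_ (MinimalConnectedContaining e f)

  J : CrossingClosed → ∀ {e f} → Crosses e f → Subset n
  J closed e×f = proj₁ (closed e×f)

  UpperCrossingClosed : Rel Edge ℓ → Set ℓ
  UpperCrossingClosed _⊴_ = ∃ λ (closed : CrossingClosed) →
    ∀ {e f} (e×f : Crosses e f) →
    ∃ λ h → h ∈ induced (J closed e×f) × h ◃ e × h ◃ f
    where open NonStrictToStrict _≡_ _⊴_ renaming (_<_ to _◃_)

  -- v₀v₁, v₁v₂, …, v_{k-1}v₀
  cyclicSteps : ∀ {k} → Vec (Fin n) (suc k) → Vec (Fin n × Fin n) (suc k)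
  cyclicSteps (v ∷ vs) = Vec.zip (v ∷ vs) (vs Vec.∷ʳ v)

  Traces : ∀ {k} → Vec (Fin n) (suc k) → Pred Spanning 0ℓ
  Traces vs C = VecAll.All (λ (u , v) → Adjacent C u v) (cyclicSteps vs)
              × (∀ e → e ∈ C → VecAny.Any (λ (u , v) → Joins e u v) (cyclicSteps vs))

  -- C is the edge set of a cycle of X, i.e. of a cyclic sequence of at least
  -- three distinct vertices with consecutive ones adjacent.
  IsCycle : Spanning → Pred Spanning 0ℓ
  IsCycle X C = C ⊆ X × ∃ λ k → ∃ λ (vs : Vec (Fin n) (3 ℕ.+ k)) → Unique vs × Traces vs C

  isCycle? : ∀ X → Decidable (IsCycle X)
  isCycle? X C = C ⊆? X ×-dec map′
    (λ { (k , _ , vs) → k , vs })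
    (λ { (k , vs , u , t) → k , bound k vs u , vs , u , t })
    (anyUpTo? (λ k → anyVec? (3 ℕ.+ k) λ vs →
       VecAllPairs.allPairs? (λ u v → ¬? (u ≟ v)) vs ×-dec
       VecAll.all? (λ (u , v) → adjacent? C u v) (cyclicSteps vs) ×-dec
       all? (λ e → e ∈? C →-dec VecAny.any? (λ (u , v) → joins? e u v) (cyclicSteps vs))) n)
    where
    bound : ∀ k (vs : Vec (Fin n) (3 ℕ.+ k)) → Unique vs → k ℕ.< n
    bound k vs u = ℕ.≤-trans (ℕ.m≤n+m (suc k) 2) (injective⇒≤ (lookup-injective u _ _))

  NoncrossingEdges : Pred Spanning 0ℓ
  NoncrossingEdges S = ∀ e f → e ∈ S → f ∈ S → ¬ Crosses e f

  module _ {_⊴_ : Rel Edge ℓ} (⊴-total : IsTotalOrder _≡_ _⊴_) where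
    private
      module ⊴ = IsTotalOrder ⊴-total

      _⊴?_ : Binary.Decidable _⊴_
      _⊴?_ = total∧dec⇒dec ⊴.reflexive ⊴.antisym ⊴.total _≟_

    BrokenCircuit : Spanning → Pred Spanning ℓ
    BrokenCircuit X B = ∃₂ λ C e → IsCycle X C × e ∈ C × (∀ f → f ∈ C → e ⊴ f) × B ≡ C - e

    brokenCircuit? : ∀ X → Decidable (BrokenCircuit X)
    brokenCircuit? X B = anySubset? λ C → any? λ e →
      isCycle? X C ×-dec e ∈? C ×-dec all? (λ f → f ∈? C →-dec e ⊴? f) ×-dec B ≟ₛ C - e

    NBC : Spanning → Pred Spanning ℓ
    NBC X S = S ⊆ X × ¬ ∃ λ B → BrokenCircuit X B × B ⊆ S

    NoncrossingNBC : Spanning → Pred Spanning ℓ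
    NoncrossingNBC X S = NBC X S × NoncrossingEdges S

    noncrossingNBC? : ∀ X → Decidable (NoncrossingNBC X)
    noncrossingNBC? X S =
      (S ⊆? X ×-dec ¬? (anySubset? λ B → brokenCircuit? X B ×-dec B ⊆? S)) ×-dec
      all? λ e → all? λ f → e ∈? S →-dec f ∈? S →-dec ¬? (crosses? e f)

    ncnbc : ℕ → Spanning → ℕ
    ncnbc k X = length (filter (λ S → noncrossingNBC? X S ×-dec ∣ S ∣ ℕ.≟ k) (subsets size))

{-# OPTIONS --safe #-}
module Submission where

-- Let cl S be the bond whose components have the same vertex sets as those of
-- a spanning subgraph S.  If the edges of S do not cross, then cl S is
-- noncrossing, and if S is moreover an NBC set then it is a forest, so
-- |S| = n - cc (cl S).  Put ν(x) = ∑ (-1)^|S| over the noncrossing NBC sets S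
-- with cl S = x.  Summing ν over the y ⊆ H gives the signed count of all
-- noncrossing NBC sets contained in H.  For H ≠ 0̂ this vanishes: adding or
-- removing the least edge of H is a sign-reversing involution, since by upper
-- crossing closure no edge of H crosses the least one.  Hence ν = μ.
-- If NC_G is graded, adding the edges of S one at a time gives a saturated
-- chain from 0̂ to cl S, so that ρ (cl S) = |S|, and χ can be summed over S.

open import Defs
open import Data.Bool.Base using (true; false)
open import Data.Fin.Base as Fin using (Fin; zero; suc)
import Data.Fin.Properties as Fin
open import Data.Fin.Subset as Subset using (Subset; inside; outside; ⊥; ⊤; _∈_; _∉_; _⊆_; _⊂_; ∣_∣)
open import Data.Fin.Subset.Induction using (⊂-wellFounded; acc)
open import Data.Fin.Subset.Properties
  using ( _∈?_; _⊆?_; _⊂?_; nonempty?; anySubset?; Empty-unique; ∉⊥; ⊆⊤; ⊆-refl; ⊆-trans; ⊆-antisym; ⊂-irref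
        ; ∣⊥∣≡0; ∣⊤∣≡n; ∣p∣≤n; p⊆q⇒∣p∣≤∣q∣; p⊂q⇒∣p∣<∣q∣; x∈p∩q⁺; x∈p∩q⁻; p∩q⊆q; p─q⊆p; x∈p∧x≢y⇒x∈p-y )
open import Data.Integer.Base as ℤ using (ℤ; +_; 0ℤ; 1ℤ; -1ℤ; _+_; _*_; _^_; _-_; -_)
import Data.Integer.Properties as ℤ
open import Algebra.Properties.AbelianGroup ℤ.+-0-abelianGroup using (inverseʳ-unique)
open import Algebra.Properties.CommutativeSemigroup ℤ.+-commutativeSemigroup using (interchange)
open import Data.List.Base as List using (List; []; _∷_; _++_; filter; length; allFin; upTo)
import Data.List.Extrema as Extrema
import Data.List.Membership.Propositional as List
open import Data.List.Membership.Propositional.Properties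
  using ( ∈-++⁺ˡ; ∈-++⁺ʳ; ∈-map⁺; ∈-map⁻; ∈-filter⁺; ∈-filter⁻; ∈-allFin; ∈-upTo⁺
        ; ∈-deduplicate⁺; ∈-deduplicate⁻ )
open import Data.List.Membership.Propositional.Properties.WithK using (unique∧set⇒bag)
import Data.List.Properties as List
open import Data.List.Relation.Binary.BagAndSetEquality using (∼bag⇒↭)
open import Data.List.Relation.Binary.Permutation.Propositional.Properties using (↭-length)
open import Data.List.Relation.Unary.All as All using (All; []; _∷_)
import Data.List.Relation.Unary.All.Properties as All
open import Data.List.Relation.Unary.AllPairs using ([]; _∷_)
open import Data.List.Relation.Unary.Any using (here; there)
open import Data.List.Relation.Unary.Unique.DecPropositional.Properties using (deduplicate-!)
open import Data.List.Relation.Unary.Unique.Propositional using (Unique)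
import Data.List.Relation.Unary.Unique.Propositional.Properties as Unique
open import Data.Nat.Base as ℕ using (ℕ; zero; suc; _∸_)
import Data.Nat.Properties as ℕ
open import Data.Product.Base using (∃; ∃₂; _×_; _,_; proj₁; proj₂)
open import Data.Sum.Base using (_⊎_; inj₁; inj₂)
open import Data.Vec.Base as Vec using (Vec; []; _∷_; here; there; _[_]≔_)
import Data.Vec.Properties as Vec
open import Data.Vec.Relation.Unary.All as VecAll using ([]; _∷_)
open import Data.Vec.Relation.Unary.AllPairs using ([]; _∷_)
import Data.Vec.Relation.Unary.Any as VecAny
import Data.Vec.Relation.Unary.Unique.Propositional as Vec
open import Function.Base using (_∘_; id; case_of_)
open import Function.Bundles using (_⇔_; mk⇔; Equivalence)
open import Induction.WellFounded using (Acc; module FixPoint)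
open import Level using (Level)
open import Relation.Binary.Bundles using (TotalOrder)
open import Relation.Binary.Construct.Closure.ReflexiveTransitive as Star using (Star; ε; _◅_; _◅◅_)
open import Relation.Binary.Core using (Rel)
import Relation.Binary.Definitions as Binary
open import Relation.Binary.PropositionalEquality hiding (J)
open import Relation.Binary.Structures using (IsEquivalence; IsTotalOrder)
open import Relation.Nullary using (¬_; Dec; does; yes; no; contradiction)
open import Relation.Nullary.Decidable using (_×-dec_; _→-dec_; ¬?; map′; dec-true; dec-false; decidable-stable)
open import Relation.Unary using (Pred; Decidable)

private
  variable
    a b ℓ ℓ′ : Level
    A : Set a
    B : Set b
    m n : ℕ

-- Sums

infixl 7 _when_
-- The Iverson bracket. Every sum below runs over all subsets and keeps its conditions as brackets,
-- so sums can be exchanged without changing their index lists.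
_when_ : ℤ → Dec A → ℤ
z when A? = [ A? ⇒ (λ _ → z) ]

when-yes : ∀ {z} (A? : Dec A) → A → z when A? ≡ z
when-yes (yes _) _ = refl
when-yes (no ¬x) x = contradiction x ¬x

when-no : ∀ {z} (A? : Dec A) → ¬ A → z when A? ≡ 0ℤ
when-no (yes x) ¬x = contradiction x ¬x
when-no (no _)  _  = refl

when-cong : ∀ {y z} (A? : Dec A) (B? : Dec B) → (A → B) → (B → A) → (A → y ≡ z) →
            y when A? ≡ z when B?
when-cong (yes x) B? f g h = trans (h x) (sym (when-yes B? (f x)))
when-cong (no ¬x) B? f g h = sym (when-no B? (¬x ∘ g))

when-cong′ : ∀ {y z} (A? : Dec A) → (A → y ≡ z) → y when A? ≡ z when A?
when-cong′ A? = when-cong A? A? id id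

when-×-dec : ∀ {z} (A? : Dec A) (B? : Dec B) → (z when B?) when A? ≡ z when (A? ×-dec B?)
when-×-dec (yes _) (yes _) = refl
when-×-dec (yes _) (no _)  = refl
when-×-dec (no _)  (yes _) = refl
when-×-dec (no _)  (no _)  = refl

when-comm : ∀ {z} (A? : Dec A) (B? : Dec B) → (z when B?) when A? ≡ (z when A?) when B?
when-comm (yes _) B?      = refl
when-comm (no _)  (yes _) = refl
when-comm (no _)  (no _)  = refl

∑-cong : ∀ {f g : A → ℤ} xs → (∀ x → f x ≡ g x) → ∑ xs f ≡ ∑ xs g
∑-cong []       f≗g = refl
∑-cong (x ∷ xs) f≗g = cong₂ _+_ (f≗g x) (∑-cong xs f≗g)

∑-0 : ∀ (xs : List A) → ∑ xs (λ _ → 0ℤ) ≡ 0ℤ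
∑-0 []       = refl
∑-0 (x ∷ xs) = trans (ℤ.+-identityˡ _) (∑-0 xs)

∑-zero : ∀ {f : A → ℤ} xs → (∀ x → f x ≡ 0ℤ) → ∑ xs f ≡ 0ℤ
∑-zero xs f≗0 = trans (∑-cong xs f≗0) (∑-0 xs)

∑-distrib-+ : ∀ (f g : A → ℤ) xs → ∑ xs (λ x → f x + g x) ≡ ∑ xs f + ∑ xs g
∑-distrib-+ f g []       = refl
∑-distrib-+ f g (x ∷ xs) = trans (cong (_+_ (f x + g x)) (∑-distrib-+ f g xs)) (interchange (f x) (g x) _ _)

∑-++ : ∀ (f : A → ℤ) xs ys → ∑ (xs ++ ys) f ≡ ∑ xs f + ∑ ys f
∑-++ f []       ys = sym (ℤ.+-identityˡ _)
∑-++ f (x ∷ xs) ys = trans (cong (_+_ (f x)) (∑-++ f xs ys)) (sym (ℤ.+-assoc (f x) _ _))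

∑-map : ∀ (f : B → ℤ) (g : A → B) xs → ∑ (List.map g xs) f ≡ ∑ xs (f ∘ g)
∑-map f g []       = refl
∑-map f g (x ∷ xs) = cong (_+_ (f (g x))) (∑-map f g xs)

∑-swap : ∀ (f : A → B → ℤ) xs ys → ∑ xs (λ x → ∑ ys (f x)) ≡ ∑ ys (λ y → ∑ xs (λ x → f x y))
∑-swap f []       ys = sym (∑-0 ys)
∑-swap f (x ∷ xs) ys = trans (cong (_+_ (∑ ys (f x))) (∑-swap f xs ys)) (sym (∑-distrib-+ (f x) _ ys))

∑-when : ∀ (f : A → ℤ) xs (B? : Dec B) → ∑ xs (λ x → f x when B?) ≡ ∑ xs f when B?
∑-when f xs (yes _) = refl
∑-when f xs (no _)  = ∑-0 xs

∑-filter : ∀ {P : Pred A ℓ} (P? : Decidable P) f xs → ∑ (filter P? xs) f ≡ ∑ xs (λ x → f x when P? x)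
∑-filter P? f []       = refl
∑-filter P? f (x ∷ xs) with P? x
... | yes _ = cong (_+_ (f x)) (∑-filter P? f xs)
... | no  _ = trans (∑-filter P? f xs) (sym (ℤ.+-identityˡ _))

∑-const : ∀ c (xs : List A) → ∑ xs (λ _ → c) ≡ c * + length xs
∑-const c []       = sym (ℤ.*-zeroʳ c)
∑-const c (x ∷ xs) = trans (cong (_+_ c) (∑-const c xs)) (sym (ℤ.*-suc c (+ length xs)))

-- Uniqueness of `xs` lets `y` contribute exactly once: past its first occurrence every bracket is
-- zero.
∑-δ : ∀ {_≟_ : Binary.DecidableEquality A} (f : A → ℤ) {xs} → Unique xs → ∀ {y} → y List.∈ xs →
      ∑ xs (λ x → f x when (y ≟ x)) ≡ f y
∑-δ {_≟_ = _≟_} f {x ∷ xs} (x∉xs ∷ xs!) {y} y∈xs with y ≟ x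
... | yes refl = trans (cong (_+_ (f x)) (rest x∉xs)) (ℤ.+-identityʳ _)
  where
  rest : ∀ {ys} → All (x ≢_) ys → ∑ ys (λ z → f z when (x ≟ z)) ≡ 0ℤ
  rest []           = refl
  rest (x≢z ∷ x∉zs) = trans (cong₂ _+_ (when-no (x ≟ _) x≢z) (rest x∉zs)) (ℤ.+-identityˡ _)
... | no y≢x with y∈xs
...   | here y≡x   = contradiction y≡x y≢x
...   | there y∈xs = trans (ℤ.+-identityˡ _) (∑-δ {_≟_ = _≟_} f xs! y∈xs)

-- Injectivity is asked on `xs` only, because `component G S` is injective on class representatives
-- but in general not on all vertices.
map⁺-∈ : ∀ (f : A → B) {xs} → (∀ {x y} → x List.∈ xs → y List.∈ xs → f x ≡ f y → x ≡ y) →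
         Unique xs → Unique (List.map f xs)
map⁺-∈ f inj []           = []
map⁺-∈ f inj (x∉xs ∷ xs!) =
  All.map⁺ (All.tabulate λ y∈xs fx≡fy → All.lookup x∉xs y∈xs (inj (here refl) (there y∈xs) fx≡fy)) ∷
  map⁺-∈ f (λ x∈ y∈ → inj (there x∈) (there y∈)) xs!

-- Subsets

∈-subsets : ∀ (S : Subset m) → S List.∈ subsets m
∈-subsets []            = here refl
∈-subsets (outside ∷ S) = ∈-++⁺ˡ (∈-map⁺ _ (∈-subsets S))
∈-subsets (inside ∷ S)  = ∈-++⁺ʳ _ (∈-map⁺ _ (∈-subsets S))

subsets-! : ∀ m → Unique (subsets m)
subsets-! zero    = [] ∷ []
subsets-! (suc m) = Unique.++⁺ (Unique.map⁺ Vec.∷-injectiveʳ (subsets-! m)) (Unique.map⁺ Vec.∷-injectiveʳ (subsets-! m))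
  λ (S∈out , S∈in) → case (∈-map⁻ _ S∈out , ∈-map⁻ _ S∈in) of λ where
    ((_ , _ , refl) , (_ , _ , ()))

⊆∧≢⇒⊂ : ∀ {p q : Subset m} → p ⊆ q → p ≢ q → p ⊂ q
⊆∧≢⇒⊂ {p = p} {q} p⊆q p≢q with Fin.any? (λ x → x ∈? q ×-dec ¬? (x ∈? p))
... | yes q⊈p = p⊆q , q⊈p
... | no  q⊆p = contradiction
  (⊆-antisym p⊆q λ {x} x∈q → decidable-stable (x ∈? p) λ x∉p → q⊆p (x , x∈q , x∉p)) p≢q

x∉p-x : ∀ (p : Subset m) {x} → x ∉ p Subset.- x
x∉p-x (_ ∷ p) {suc x} (there x∈) = x∉p-x p x∈

insert : Fin m → Subset m → Subset m
insert e S = S [ e ]≔ inside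

∈-insert : ∀ e (S : Subset m) → e ∈ insert e S
∈-insert e S = Vec.[]≔-updates S e

⊆-insert : ∀ e (S : Subset m) → S ⊆ insert e S
⊆-insert zero    (_ ∷ S) here      = here
⊆-insert zero    (_ ∷ S) (there p) = there p
⊆-insert (suc e) (_ ∷ S) here      = here
⊆-insert (suc e) (_ ∷ S) (there p) = there (⊆-insert e S p)

∈-insert⁻ : ∀ e (S : Subset m) {f} → f ∈ insert e S → f ≡ e ⊎ f ∈ S
∈-insert⁻ zero    (_ ∷ S) here      = inj₁ refl
∈-insert⁻ zero    (_ ∷ S) (there p) = inj₂ (there p)
∈-insert⁻ (suc e) (_ ∷ S) here      = inj₂ here
∈-insert⁻ (suc e) (_ ∷ S) (there p) with ∈-insert⁻ e S p
... | inj₁ refl = inj₁ refl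
... | inj₂ q    = inj₂ (there q)

∣insert∣ : ∀ e (S : Subset m) → e ∉ S → ∣ insert e S ∣ ≡ suc ∣ S ∣
∣insert∣ zero    (inside ∷ S)  e∉S = contradiction here e∉S
∣insert∣ zero    (outside ∷ S) e∉S = refl
∣insert∣ (suc e) (inside ∷ S)  e∉S = cong suc (∣insert∣ e S (e∉S ∘ there))
∣insert∣ (suc e) (outside ∷ S) e∉S = ∣insert∣ e S (e∉S ∘ there)

-- The tail is built up first, behind an `outside` head; element `zero` is inserted last if it is
-- needed. This is how edge sets are grown one edge at a time.
insert-induction : ∀ (P : Pred (Subset m) ℓ) → P ⊥ → (∀ {S} e → e ∉ S → P S → P (insert e S)) → ∀ S → P S
insert-induction P base step []      = base
insert-induction P base step (s ∷ S) = extend s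
  where
  ih : P (outside ∷ S)
  ih = insert-induction (P ∘ (outside ∷_)) base (λ e e∉S → step (suc e) (λ { (there e∈S) → e∉S e∈S })) S

  extend : ∀ s → P (s ∷ S)
  extend outside = ih
  extend inside  = step zero (λ ()) ih

-- The sign-reversing involution. Splitting the sum by the first bit, the two halves cancel termwise
-- if `e` is `zero`; otherwise each half vanishes by recursion.
∑-toggle : ∀ e (f : Subset m → ℤ) → (∀ S → e ∉ S → f S + f (insert e S) ≡ 0ℤ) → ∑ (subsets m) f ≡ 0ℤ
∑-toggle {suc m} e f cancels = trans (∑-++ f (List.map _ (subsets m)) _)
  (trans (cong₂ _+_ (∑-map f _ (subsets m)) (∑-map f _ (subsets m))) (halves e cancels))
  where
  halves : ∀ e → (∀ S → e ∉ S → f S + f (insert e S) ≡ 0ℤ) →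
           ∑ (subsets m) (f ∘ (outside ∷_)) + ∑ (subsets m) (f ∘ (inside ∷_)) ≡ 0ℤ
  halves zero    cancels = trans (sym (∑-distrib-+ _ _ (subsets m)))
    (∑-zero (subsets m) λ S → cancels (outside ∷ S) λ ())
  halves (suc e) cancels = cong₂ _+_ (half outside) (half inside)
    where
    half : ∀ s → ∑ (subsets m) (f ∘ (s ∷_)) ≡ 0ℤ
    half s = ∑-toggle e (f ∘ (s ∷_)) λ S e∉S → cancels (s ∷ S) λ { (there e∈S) → e∉S e∈S }

module _ {P : Pred (Fin m) ℓ} (P? : Decidable P) where

  ∈-setOf⁺ : ∀ {x} → P x → x ∈ setOf P?
  ∈-setOf⁺ {x} px = Vec.lookup⇒[]= x _ (trans (Vec.lookup∘tabulate _ x) (dec-true (P? x) px))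

  ∈-setOf⁻ : ∀ {x} → x ∈ setOf P? → P x
  ∈-setOf⁻ {x} x∈ with P? x | trans (sym (Vec.lookup∘tabulate (does ∘ P?) x)) (Vec.[]=⇒lookup x∈)
  ... | yes px | _ = px

∣setOf∣ : ∀ {P : Pred (Fin m) ℓ} (P? : Decidable P) → ∣ setOf P? ∣ ≡ length (filter P? (allFin m))
∣setOf∣ P? = count P? id
  where
  -- The tail of `allFin` is a tabulation of `suc`, so the induction needs an arbitrary tabulated
  -- function.
  count : ∀ {k m} {P : Pred (Fin m) ℓ} (P? : Decidable P) (f : Fin k → Fin m) →
          ∣ Vec.tabulate (does ∘ P? ∘ f) ∣ ≡ length (filter P? (List.tabulate f))
  count {k = zero}  P? f = refl
  count {k = suc k} P? f with P? (f zero)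
  ... | yes _ = cong suc (count P? (f ∘ suc))
  ... | no _  = count P? (f ∘ suc)

least : ∀ {_≼_ : Rel (Fin m) ℓ} → IsTotalOrder _≡_ _≼_ → ∀ {P : Pred (Fin m) ℓ′} → Decidable P →
        ∃ P → ∃ λ x → P x × ∀ {y} → P y → x ≼ y
least {m = m} isTotalOrder P? (x , px) =
  -- The given witness is the default value of `argmin`; since it satisfies `P`, so does the result.
  argmin id x candidates , argmin-all id px (All.all-filter P? (allFin m)) ,
  λ py → All.lookup (f[argmin]≤f[xs] x candidates) (∈-filter⁺ P? (∈-allFin _) py)
  where
  totalOrder : TotalOrder _ _ _
  totalOrder = record { isTotalOrder = isTotalOrder }

  open Extrema totalOrder
  candidates = filter P? (allFin m)

-- Classes of an equivalence relation, counted by their least elements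

module Representatives {n} {_~_ : Rel (Fin n) ℓ} (~-equiv : IsEquivalence _~_) (_~?_ : Binary.Decidable _~_) where
  open IsEquivalence ~-equiv renaming (refl to ~-refl; sym to ~-sym; trans to ~-trans)

  IsRep : Pred (Fin n) ℓ
  IsRep v = ∀ u → u ~ v → v Fin.≤ u

  isRep? : Decidable IsRep
  isRep? v = Fin.all? λ u → u ~? v →-dec v Fin.≤? u

  reps : Subset n
  reps = setOf isRep?

  ∈-reps⁺ : ∀ {v} → IsRep v → v ∈ reps
  ∈-reps⁺ = ∈-setOf⁺ isRep?

  ∈-reps⁻ : ∀ {v} → v ∈ reps → IsRep v
  ∈-reps⁻ = ∈-setOf⁻ isRep?

  rep-unique : ∀ {r s} → IsRep r → IsRep s → r ~ s → r ≡ s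
  rep-unique {r} {s} r-rep s-rep r~s = Fin.≤-antisym (r-rep s (~-sym r~s)) (s-rep r r~s)

  hasRep : ∀ v → ∃ λ r → IsRep r × r ~ v
  hasRep v with least Fin.≤-isTotalOrder (_~? v) (v , ~-refl)
  ... | r , r~v , r-least = r , (λ u u~r → r-least (~-trans u~r r~v)) , r~v

module _ {_~_ : Rel (Fin n) ℓ} {_≈_ : Rel (Fin n) ℓ′}
         (~-equiv : IsEquivalence _~_) (_~?_ : Binary.Decidable _~_)
         (≈-equiv : IsEquivalence _≈_) (_≈?_ : Binary.Decidable _≈_)
         (~⇒≈ : ∀ {u v} → u ~ v → u ≈ v) where
  private
    module ~ where
      open Representatives ~-equiv _~?_ public
      open IsEquivalence ~-equiv public
    module ≈ where
      open Representatives ≈-equiv _≈?_ public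
      open IsEquivalence ≈-equiv public

  rep-coarsen : ∀ {v} → ≈.IsRep v → ~.IsRep v
  rep-coarsen v-rep u u~v = v-rep u (~⇒≈ u~v)

  reps-coarsen : ≈.reps ⊆ ~.reps
  reps-coarsen = ~.∈-reps⁺ ∘ rep-coarsen ∘ ≈.∈-reps⁻

  module _ (∣~∣≤∣≈∣ : ∣ ~.reps ∣ ℕ.≤ ∣ ≈.reps ∣) where

    -- A representative lost in the coarsening would make the inclusion `reps-coarsen` proper,
    -- against the assumed inequality of sizes.
    rep-refine : ∀ {v} → ~.IsRep v → ≈.IsRep v
    rep-refine {v} v-rep with ≈.isRep? v
    ... | yes v-rep′ = v-rep′
    ... | no ¬v-rep  = contradiction ∣~∣≤∣≈∣ (ℕ.<⇒≱ (p⊂q⇒∣p∣<∣q∣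
      (reps-coarsen , v , ~.∈-reps⁺ v-rep , ¬v-rep ∘ ≈.∈-reps⁻)))

    -- By `rep-refine` the fine representatives of `u` and `v` are also coarse ones. They lie in one
    -- coarse class, so they coincide.
    coarsen-reflects : ∀ {u v} → u ≈ v → u ~ v
    coarsen-reflects {u} {v} u≈v with ~.hasRep u | ~.hasRep v
    ... | r , r-rep , r~u | s , s-rep , s~v
      with refl ← ≈.rep-unique (rep-refine r-rep) (rep-refine s-rep)
                    (≈.trans (~⇒≈ r~u) (≈.trans u≈v (≈.sym (~⇒≈ s~v))))
      = ~.trans (~.sym r~u) s~v

  -- At most the classes of `p` and `q` have been united; the three cases are those of
  -- `insert-split`.
  Merged : Fin n → Fin n → Set _
  Merged p q = ∀ {u v} → u ≈ v → u ~ v ⊎ (u ~ p × q ~ v) ⊎ (u ~ q × p ~ v)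

  private
    -- The least elements after merging are the old ones except q.
    merge-reps : ∀ {p q} → ~.IsRep p → ~.IsRep q → p Fin.< q → p ≈ q → Merged p q →
                 ∣ ~.reps ∣ ≡ suc ∣ ≈.reps ∣
    merge-reps {p} {q} p-rep q-rep p<q p≈q merged =
      trans (cong ∣_∣ (⊆-antisym to from)) (∣insert∣ q ≈.reps (q∉ ∘ ≈.∈-reps⁻))
      where
      q∉ : ¬ ≈.IsRep q
      q∉ q-rep′ = ℕ.<⇒≱ p<q (q-rep′ p p≈q)

      rep : ∀ {v} → v ≢ q → ~.IsRep v → ≈.IsRep v
      rep v≢q v-rep u u≈v with merged u≈v
      ... | inj₁ u~v                = v-rep u u~v
      ... | inj₂ (inj₁ (_ , q~v))   = contradiction (sym (~.rep-unique q-rep v-rep q~v)) v≢q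
      -- Here `v` is `p`, and every element of the class of `q` is at least `q`, hence above `p`.
      ... | inj₂ (inj₂ (u~q , p~v)) with refl ← ~.rep-unique p-rep v-rep p~v =
        ℕ.≤-trans (ℕ.<⇒≤ p<q) (q-rep u u~q)

      to : ~.reps ⊆ insert q ≈.reps
      to {v} v∈ with v Fin.≟ q
      ... | yes refl = ∈-insert q ≈.reps
      ... | no v≢q   = ⊆-insert q ≈.reps (≈.∈-reps⁺ (rep v≢q (~.∈-reps⁻ v∈)))

      from : insert q ≈.reps ⊆ ~.reps
      from v∈ with ∈-insert⁻ q ≈.reps v∈
      ... | inj₁ refl = ~.∈-reps⁺ q-rep
      ... | inj₂ v∈≈  = reps-coarsen v∈≈

  -- `merge-reps` expects two least elements with the smaller one first, so `p` and `q` are replaced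
  -- by their representatives, whose comparison fixes the order.
  ∣reps∣-merge : ∀ {p q} → ¬ (p ~ q) → p ≈ q → Merged p q → ∣ ~.reps ∣ ≡ suc ∣ ≈.reps ∣
  ∣reps∣-merge {p} {q} p≁q p≈q merged with ~.hasRep p | ~.hasRep q
  ... | r , r-rep , r~p | s , s-rep , s~q with Fin.<-cmp r s
  ...   | Binary.tri< r<s _ _ = merge-reps r-rep s-rep r<s r≈s λ u≈v → case merged u≈v of λ where
            (inj₁ u~v)                → inj₁ u~v
            (inj₂ (inj₁ (u~p , q~v))) → inj₂ (inj₁ (~.trans u~p (~.sym r~p) , ~.trans s~q q~v))
            (inj₂ (inj₂ (u~q , p~v))) → inj₂ (inj₂ (~.trans u~q (~.sym s~q) , ~.trans r~p p~v))
    where r≈s = ≈.trans (~⇒≈ r~p) (≈.trans p≈q (≈.sym (~⇒≈ s~q)))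
  ...   | Binary.tri≈ _ refl _ = contradiction (~.trans (~.sym r~p) s~q) p≁q
  ...   | Binary.tri> _ _ s<r = merge-reps s-rep r-rep s<r s≈r λ u≈v → case merged u≈v of λ where
            (inj₁ u~v)                → inj₁ u~v
            (inj₂ (inj₁ (u~p , q~v))) → inj₂ (inj₂ (~.trans u~p (~.sym r~p) , ~.trans s~q q~v))
            (inj₂ (inj₂ (u~q , p~v))) → inj₂ (inj₁ (~.trans u~q (~.sym s~q) , ~.trans r~p p~v))
    where s≈r = ≈.trans (~⇒≈ s~q) (≈.trans (≈.sym p≈q) (≈.sym (~⇒≈ r~p)))

-- Connectivity, cycles and bonds

module GraphProperties {n} (G : Graph n) where
  open Graph G

  joins-sym : ∀ {e u v} → Joins G e u v → Joins G e v u
  joins-sym (inj₁ e≡uv) = inj₂ e≡uv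
  joins-sym (inj₂ e≡vu) = inj₁ e≡vu

  joins-≢ : ∀ {e u v} → Joins G e u v → u ≢ v
  joins-≢ {e} (inj₁ (refl , hi≡lo)) refl = ℕ.<⇒≢ (lo<hi e) (cong Fin.toℕ (sym hi≡lo))
  joins-≢ {e} (inj₂ (refl , hi≡lo)) refl = ℕ.<⇒≢ (lo<hi e) (cong Fin.toℕ (sym hi≡lo))

  joins-injective : ∀ {e f u v} → Joins G e u v → Joins G f u v → e ≡ f
  joins-injective {e} {f} (inj₁ (refl , refl)) (inj₁ (lo≡ , hi≡)) = simple (sym lo≡) (sym hi≡)
  joins-injective {e} {f} (inj₁ (refl , refl)) (inj₂ (lo≡ , hi≡)) =
    contradiction (lo<hi f) (ℕ.<⇒≯ (subst₂ Fin._<_ (sym hi≡) (sym lo≡) (lo<hi e)))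
  joins-injective {e} {f} (inj₂ (refl , refl)) (inj₁ (lo≡ , hi≡)) =
    contradiction (lo<hi f) (ℕ.<⇒≯ (subst₂ Fin._<_ (sym hi≡) (sym lo≡) (lo<hi e)))
  joins-injective {e} {f} (inj₂ (refl , refl)) (inj₂ (lo≡ , hi≡)) = simple (sym lo≡) (sym hi≡)

  joins-endpoint : ∀ {e a b u v} → Joins G e a b → Joins G e u v → u ≡ a × v ≡ b ⊎ u ≡ b × v ≡ a
  joins-endpoint (inj₁ (refl , refl)) (inj₁ (refl , refl)) = inj₁ (refl , refl)
  joins-endpoint (inj₁ (refl , refl)) (inj₂ (refl , refl)) = inj₂ (refl , refl)
  joins-endpoint (inj₂ (refl , refl)) (inj₁ (refl , refl)) = inj₂ (refl , refl)
  joins-endpoint (inj₂ (refl , refl)) (inj₂ (refl , refl)) = inj₁ (refl , refl)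

  adjacent-sym : ∀ {S u v} → Adjacent G S u v → Adjacent G S v u
  adjacent-sym (e , e∈S , e≡uv) = e , e∈S , joins-sym e≡uv

  adjacent-mono : ∀ {S T u v} → S ⊆ T → Adjacent G S u v → Adjacent G T u v
  adjacent-mono S⊆T (e , e∈S , e≡uv) = e , S⊆T e∈S , e≡uv

  connected-mono : ∀ {S T u v} → S ⊆ T → Connected G S u v → Connected G T u v
  connected-mono S⊆T = Star.map (adjacent-mono S⊆T)

  connected-sym : ∀ {S u v} → Connected G S u v → Connected G S v u
  connected-sym = Star.reverse adjacent-sym

  connected-equiv : ∀ S → IsEquivalence (Connected G S)
  connected-equiv S = record { refl = ε ; sym = connected-sym ; trans = _◅◅_ }

  edge-connected : ∀ {S e} → e ∈ S → Connected G S (lo e) (hi e)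
  edge-connected {e = e} e∈S = (e , e∈S , inj₁ (refl , refl)) ◅ ε

  ends-connected : ∀ {S e u v} → Joins G e u v → Connected G S u v → Connected G S (lo e) (hi e)
  ends-connected (inj₁ (refl , refl)) u~v = u~v
  ends-connected (inj₂ (refl , refl)) u~v = connected-sym u~v

  joined-connected : ∀ {S e u v} → Connected G S (lo e) (hi e) → Joins G e u v → Connected G S u v
  joined-connected lo~hi (inj₁ (refl , refl)) = lo~hi
  joined-connected lo~hi (inj₂ (refl , refl)) = connected-sym lo~hi

  ∈-component⁺ : ∀ {S u v} → Connected G S u v → v ∈ component G S u
  ∈-component⁺ {S} {u} = ∈-setOf⁺ (connected? G S u)

  ∈-component⁻ : ∀ {S u v} → v ∈ component G S u → Connected G S u v
  ∈-component⁻ {S} {u} = ∈-setOf⁻ (connected? G S u)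

  component-cong : ∀ {S u v} → Connected G S u v → component G S u ≡ component G S v
  component-cong u~v = ⊆-antisym
    (λ w∈ → ∈-component⁺ (connected-sym u~v ◅◅ ∈-component⁻ w∈))
    (λ w∈ → ∈-component⁺ (u~v ◅◅ ∈-component⁻ w∈))

  component-injective : ∀ {S u v} → component G S u ≡ component G S v → Connected G S u v
  component-injective {S} {u} {v} eq = ∈-component⁻ (subst (v ∈_) (sym eq) (∈-component⁺ ε))

  ∈-induced⁺ : ∀ {W e} → lo e ∈ W → hi e ∈ W → e ∈ induced G W
  ∈-induced⁺ {W} lo∈ hi∈ = ∈-setOf⁺ (λ e → lo e ∈? W ×-dec hi e ∈? W) (lo∈ , hi∈)

  ∈-induced⁻ : ∀ {W e} → e ∈ induced G W → lo e ∈ W × hi e ∈ W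
  ∈-induced⁻ {W} = ∈-setOf⁻ (λ e → lo e ∈? W ×-dec hi e ∈? W)

  ∈-π⁻ : ∀ {S B} → B List.∈ π G S → ∃ λ v → B ≡ component G S v
  ∈-π⁻ {S} B∈ with ∈-map⁻ (component G S) (∈-deduplicate⁻ _≟ₛ_ _ B∈)
  ... | v , _ , B≡ = v , B≡

  component∈π : ∀ {S} v → component G S v List.∈ π G S
  component∈π {S} v = ∈-deduplicate⁺ _≟ₛ_ (∈-map⁺ (component G S) (∈-allFin v))

  -- Numbers of connected components

  reps : Spanning → Subset n
  reps S = Representatives.reps (connected-equiv S) (connected? G S)

  -- The components of the representatives and the blocks in `π G S` form two duplicate-free lists
  -- with the same members, hence of the same length. This makes `cc` the size of a subset, to which
  -- inclusions apply.
  ∣reps∣ : ∀ S → ∣ reps S ∣ ≡ cc G S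
  ∣reps∣ S = trans (∣setOf∣ isRep?)
    (trans (sym (List.length-map (component G S) repList))
      (↭-length (∼bag⇒↭ (unique∧set⇒bag blocks! (deduplicate-! _≟ₛ_ _) (mk⇔ to from)))))
    where
    open Representatives (connected-equiv S) (connected? G S) hiding (reps)
    repList = filter isRep? (allFin n)

    isRep : ∀ {v} → v List.∈ repList → IsRep v
    isRep v∈ = proj₂ (∈-filter⁻ isRep? {xs = allFin n} v∈)

    blocks! : Unique (List.map (component G S) repList)
    blocks! = map⁺-∈ (component G S)
      (λ u∈ v∈ eq → rep-unique (isRep u∈) (isRep v∈) (component-injective eq))
      (Unique.filter⁺ isRep? (Unique.allFin⁺ n))

    to : ∀ {B} → B List.∈ List.map (component G S) repList → B List.∈ π G S
    to B∈ with ∈-map⁻ (component G S) B∈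
    ... | v , _ , refl = component∈π v

    from : ∀ {B} → B List.∈ π G S → B List.∈ List.map (component G S) repList
    from B∈ with ∈-π⁻ B∈
    ... | v , refl with hasRep v
    ... | r , r-rep , r~v = subst (List._∈ _) (component-cong r~v)
      (∈-map⁺ (component G S) (∈-filter⁺ isRep? (∈-allFin r) r-rep))

  cc-coarsen-reflects : ∀ {S T} → (∀ {u v} → Connected G S u v → Connected G T u v) → cc G S ℕ.≤ cc G T →
                        ∀ {u v} → Connected G T u v → Connected G S u v
  cc-coarsen-reflects {S} {T} S⇒T cc≤ =
    coarsen-reflects (connected-equiv S) (connected? G S) (connected-equiv T) (connected? G T) S⇒T
      (subst₂ ℕ._≤_ (sym (∣reps∣ S)) (sym (∣reps∣ T)) cc≤)

  cc-coarsen : ∀ {S T} → (∀ {u v} → Connected G S u v → Connected G T u v) → cc G T ℕ.≤ cc G S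
  cc-coarsen {S} {T} S⇒T = subst₂ ℕ._≤_ (∣reps∣ T) (∣reps∣ S) (p⊆q⇒∣p∣≤∣q∣
    (reps-coarsen (connected-equiv S) (connected? G S) (connected-equiv T) (connected? G T) S⇒T))

  cc-cong : ∀ {S T} → (∀ {u v} → Connected G S u v → Connected G T u v) →
            (∀ {u v} → Connected G T u v → Connected G S u v) → cc G S ≡ cc G T
  cc-cong S⇒T T⇒S = ℕ.≤-antisym (cc-coarsen T⇒S) (cc-coarsen S⇒T)

  cc≤n : ∀ S → cc G S ℕ.≤ n
  cc≤n S = subst (ℕ._≤ n) (∣reps∣ S) (∣p∣≤n (reps S))

  connected-⊥ : ∀ {u v} → Connected G ⊥ u v → u ≡ v
  connected-⊥ ε                   = refl
  connected-⊥ ((_ , e∈⊥ , _) ◅ _) = contradiction e∈⊥ ∉⊥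

  cc-⊥ : cc G ⊥ ≡ n
  cc-⊥ = ℕ.≤-antisym (cc≤n ⊥) (subst₂ ℕ._≤_ (∣⊤∣≡n n) (∣reps∣ ⊥)
    (p⊆q⇒∣p∣≤∣q∣ {p = ⊤} λ _ → ∈-reps⁺ λ _ u~v → ℕ.≤-reflexive (cong Fin.toℕ (sym (connected-⊥ u~v)))))
    where open Representatives (connected-equiv ⊥) (connected? G ⊥)

  -- Repeated uses of `e` are cut out along the walk, so that at most one survives, in one of two
  -- directions.
  insert-split : ∀ {S e u v} → Connected G (insert e S) u v → Connected G S u v ⊎
                 (Connected G S u (lo e) × Connected G S (hi e) v) ⊎
                 (Connected G S u (hi e) × Connected G S (lo e) v)
  insert-split ε = inj₁ ε
  insert-split {S} {e} ((f , f∈ , f≡uw) ◅ w~v) with ∈-insert⁻ e S f∈ | insert-split {S} {e} w~v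
  ... | inj₂ f∈S | inj₁ w~v                = inj₁ ((f , f∈S , f≡uw) ◅ w~v)
  ... | inj₂ f∈S | inj₂ (inj₁ (w~p , q~v)) = inj₂ (inj₁ ((f , f∈S , f≡uw) ◅ w~p , q~v))
  ... | inj₂ f∈S | inj₂ (inj₂ (w~q , p~v)) = inj₂ (inj₂ ((f , f∈S , f≡uw) ◅ w~q , p~v))
  ... | inj₁ refl | w~v with f≡uw | w~v
  ...   | inj₁ (refl , refl) | inj₁ q~v              = inj₂ (inj₁ (ε , q~v))
  ...   | inj₁ (refl , refl) | inj₂ (inj₁ (_ , q~v)) = inj₂ (inj₁ (ε , q~v))
  ...   | inj₁ (refl , refl) | inj₂ (inj₂ (_ , p~v)) = inj₁ p~v
  ...   | inj₂ (refl , refl) | inj₁ p~v              = inj₂ (inj₂ (ε , p~v))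
  ...   | inj₂ (refl , refl) | inj₂ (inj₁ (_ , q~v)) = inj₁ q~v
  ...   | inj₂ (refl , refl) | inj₂ (inj₂ (_ , p~v)) = inj₂ (inj₂ (ε , p~v))

  cc-insert : ∀ {S e} → ¬ Connected G S (lo e) (hi e) → cc G S ≡ suc (cc G (insert e S))
  cc-insert {S} {e} lo≁hi = subst₂ (λ i j → i ≡ suc j) (∣reps∣ S) (∣reps∣ (insert e S))
    (∣reps∣-merge (connected-equiv S) (connected? G S) (connected-equiv _) (connected? G (insert e S))
      (connected-mono (⊆-insert e S)) lo≁hi (edge-connected (∈-insert e S)) insert-split)

  -- `cyclicSteps` with the last vertex freed from being the first one, as inductions along the walk
  -- require.
  steps : ∀ {k} → Fin n → Vec (Fin n) k → Fin n → Vec (Fin n × Fin n) (suc k)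
  steps v vs w = Vec.zip (v ∷ vs) (vs Vec.∷ʳ w)

  AllAdjacent : ∀ {k} → Spanning → Vec (Fin n × Fin n) k → Set
  AllAdjacent S = VecAll.All (λ (u , v) → Adjacent G S u v)

  -- Cycles with one edge removed

  module _ {C H : Spanning} {e : Edge} (C-e⊆H : ∀ {f} → f ∈ C → f ≢ e → f ∈ H) where

    private
      reroute : ∀ {u v} → Adjacent G C u v → ¬ Joins G e u v → Connected G H u v
      reroute (f , f∈C , f≡uv) e≢uv = (f , C-e⊆H f∈C (λ { refl → e≢uv f≡uv }) , f≡uv) ◅ ε

      -- A step along `e` would visit its end `a`, which the walk misses.
      avoid : ∀ {k a b y x} {ys : Vec (Fin n) k} → Joins G e a b → VecAll.All (a ≢_) (y ∷ ys) → a ≢ x →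
              AllAdjacent C (steps y ys x) → Connected G H y x
      avoid {ys = []} e≡ab (a≢y ∷ []) a≢x (y–x ∷ []) = reroute y–x λ e≡yx →
        case joins-endpoint e≡ab e≡yx of λ where
          (inj₁ (y≡a , _)) → a≢y (sym y≡a)
          (inj₂ (_ , x≡a)) → a≢x (sym x≡a)
      avoid {ys = _ ∷ _} e≡ab (a≢y ∷ a≢z ∷ a∉ys) a≢x (y–z ∷ adj) =
        reroute y–z (λ e≡yz → case joins-endpoint e≡ab e≡yz of λ where
          (inj₁ (y≡a , _)) → a≢y (sym y≡a)
          (inj₂ (_ , z≡a)) → a≢z (sym z≡a))
        ◅◅ avoid e≡ab (a≢z ∷ a∉ys) a≢x adj

      -- The ends `a`, `b` of `e` appear in the order in which the walk meets them. Steps before the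
      -- first use of `e` lie in `H` by the choice of that use, later ones because a simple walk
      -- does not return to `a`.
      path-ends : ∀ {k y x} {ys : Vec (Fin n) k} → Vec.Unique (y ∷ ys) → VecAll.All (x ≢_) (y ∷ ys) →
                  AllAdjacent C (steps y ys x) → VecAny.Any (λ (u , v) → Joins G e u v) (steps y ys x) →
                  ∃₂ λ a b → Joins G e a b × Connected G H y a × Connected G H b x
      path-ends {ys = []} _ _ _ (VecAny.here e≡yx) = _ , _ , e≡yx , ε , ε
      path-ends {y = y} {ys = z ∷ _} (y∉ys ∷ ys!) (x≢y ∷ x∉ys) (y–z ∷ adj) e∈ with joins? G e y z | e∈
      ... | yes e≡yz | _ = _ , _ , e≡yz , ε , avoid e≡yz y∉ys (≢-sym x≢y) adj
      ... | no e≢yz  | VecAny.here e≡yz = contradiction e≡yz e≢yz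
      ... | no e≢yz  | VecAny.there e∈  with path-ends ys! x∉ys adj e∈
      ...   | a , b , e≡ab , z~a , b~x = a , b , e≡ab , reroute y–z e≢yz ◅◅ z~a , b~x

    -- The steps of the cycle other than e form a path in H joining the ends of e;
    -- that no other step uses e needs at least three distinct vertices.
    cycle-closes : IsCycle G ⊤ C → e ∈ C → Connected G H (lo e) (hi e)
    cycle-closes (_ , _ , u ∷ w ∷ z ∷ vs , (u≢w ∷ u≢z ∷ u∉vs) ∷ (w≢z ∷ w∉vs) ∷ zvs! , u–w ∷ w–z ∷ adj , e∈steps) e∈C
      with joins? G e u w
    ... | yes e≡uw = ends-connected e≡uw (connected-sym
        (reroute w–z (λ e≡wz → case joins-endpoint e≡uw e≡wz of λ where
          (inj₁ (w≡u , _)) → u≢w (sym w≡u)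
          (inj₂ (_ , z≡u)) → u≢z (sym z≡u))
        ◅◅ avoid (joins-sym e≡uw) (w≢z ∷ w∉vs) (≢-sym u≢w) adj))
    ... | no e≢uw with e∈steps e e∈C
    ...   | VecAny.here e≡uw = contradiction e≡uw e≢uw
    ...   | VecAny.there e∈ with path-ends ((w≢z ∷ w∉vs) ∷ zvs!) (u≢w ∷ u≢z ∷ u∉vs) (w–z ∷ adj) e∈
    ...     | a , b , e≡ab , w~a , b~u = ends-connected (joins-sym e≡ab) (b~u ◅◅ reroute u–w e≢uw ◅◅ w~a)

  -- Simple paths, and the cycle closed by a new edge

  data Path (S : Spanning) (v : Fin n) : ∀ {k} → Fin n → Vec (Fin n) k → Set where
    []  : Path S v v []
    _∷_ : ∀ {k u w} {ws : Vec (Fin n) k} → Adjacent G S u w → Path S v w ws → Path S v u (w ∷ ws)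

  SimplePath : Spanning → Fin n → Fin n → Set
  SimplePath S u v = ∃₂ λ k (ws : Vec (Fin n) k) → Vec.Unique (u ∷ ws) × Path S v u ws

  -- If `u` already lies on the path, the part starting at `u` is the desired simple path; otherwise
  -- `u` may be put in front.
  shortcut : ∀ {S v k w} {ws : Vec (Fin n) k} u → Vec.Unique (w ∷ ws) → Path S v w ws →
             SimplePath S u v ⊎ VecAll.All (u ≢_) (w ∷ ws)
  shortcut {w = w} u ws! p with u Fin.≟ w
  ... | yes refl = inj₁ (_ , _ , ws! , p)
  shortcut u ws! [] | no u≢w = inj₂ (u≢w ∷ [])
  shortcut u (_ ∷ ws!) (_ ∷ p) | no u≢w with shortcut u ws! p
  ... | inj₁ found = inj₁ found
  ... | inj₂ u∉ws  = inj₂ (u≢w ∷ u∉ws)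

  connected⇒simplePath : ∀ {S u v} → Connected G S u v → SimplePath S u v
  connected⇒simplePath ε                 = _ , [] , [] ∷ [] , []
  connected⇒simplePath {u = u} (u–w ◅ w~v) with connected⇒simplePath w~v
  ... | _ , _ , ws! , p with shortcut u ws! p
  ...   | inj₁ found = found
  ...   | inj₂ u∉ws  = _ , _ , u∉ws ∷ ws! , u–w ∷ p

  path-steps : ∀ {S T v x k u} {ws : Vec (Fin n) k} → S ⊆ T → Path S v u ws → Adjacent G T v x →
               AllAdjacent T (steps u ws x)
  path-steps S⊆T []        v–x = v–x ∷ []
  path-steps S⊆T (u–w ∷ p) v–x = adjacent-mono S⊆T u–w ∷ path-steps S⊆T p v–x

  Traced : ∀ {k} → Edge → Vec (Fin n × Fin n) k → Set
  Traced e = VecAny.Any (λ (u , v) → Joins G e u v)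

  -- Each step gets an edge that is both in `T` and among the steps, which is the membership
  -- condition of the cycle in `closed-walk⇒cycle`.
  traced : ∀ {T k} {xs : Vec (Fin n × Fin n) k} → AllAdjacent T xs →
           VecAll.All (λ (u , v) → ∃ λ e → (e ∈ T × Traced e xs) × Joins G e u v) xs
  traced []                     = []
  traced ((e , e∈T , e≡) ∷ adj) = (e , (e∈T , VecAny.here e≡) , e≡) ∷
    VecAll.map (λ (e , (e∈T , e∈xs) , e≡) → e , (e∈T , VecAny.there e∈xs) , e≡) (traced adj)

  closed-walk⇒cycle : ∀ {T k} (vs : Vec (Fin n) (3 ℕ.+ k)) → Vec.Unique vs → AllAdjacent T (cyclicSteps G vs) →
                      ∃₂ λ C e → IsCycle G ⊤ C × C ⊆ T × e ∈ C
  closed-walk⇒cycle {T} vs@(_ ∷ _ ∷ _) vs! adj with traced adj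
  ... | tr@((e , e∈ , _) ∷ _) =
    setOf C? , e ,
    (⊆⊤ , _ , vs , vs! , VecAll.map (λ (f , f∈ , f≡) → f , ∈-setOf⁺ C? f∈ , f≡) tr , λ f f∈C → proj₂ (∈-setOf⁻ C? f∈C)) ,
    (λ f∈C → proj₁ (∈-setOf⁻ C? f∈C)) , ∈-setOf⁺ C? e∈
    where
    C? : Decidable (λ f → f ∈ T × Traced f (cyclicSteps G vs))
    C? f = f ∈? T ×-dec VecAny.any? (λ (u , v) → joins? G f u v) (cyclicSteps G vs)

  -- A simple path from `u` to `v` in `S` is closed by `e`. It has at least three vertices: `e` is
  -- no loop, and by simplicity a one-edge path would be `e` itself, which is not in `S`.
  connected⇒cycle : ∀ {S e u v} → e ∉ S → Joins G e u v → Connected G S u v →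
                    ∃₂ λ C f → IsCycle G ⊤ C × C ⊆ insert e S × f ∈ C
  connected⇒cycle {S} {e} {u} e∉S e≡uv u~v with connected⇒simplePath u~v
  ... | _ , [] , _ , [] = contradiction refl (joins-≢ e≡uv)
  ... | _ , _ ∷ [] , _ , (f , f∈S , f≡uv) ∷ [] =
    contradiction (subst (_∈ S) (joins-injective f≡uv e≡uv) f∈S) e∉S
  ... | _ , ws@(_ ∷ _ ∷ _) , ws! , p = closed-walk⇒cycle (u ∷ ws) ws!
    (path-steps (⊆-insert e S) p (e , ∈-insert e S , joins-sym e≡uv))

  -- Noncrossing edges and noncrossing components

  exit : ∀ {S p q} {Q : Pred (Fin n) ℓ} → Decidable Q → Connected G S p q → Q p → ¬ Q q →
         ∃₂ λ x y → Connected G S p x × Adjacent G S x y × Q x × ¬ Q y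
  exit Q? ε qp ¬qp = contradiction qp ¬qp
  exit Q? (_◅_ {j = w} p–w w~q) qp ¬qq with Q? w
  ... | no ¬qw = _ , _ , ε , p–w , qp , ¬qw
  ... | yes qw with exit Q? w~q qw ¬qq
  ...   | x , y , w~x , x–y , qx , ¬qy = x , y , p–w ◅ w~x , x–y , qx , ¬qy

  joins-< : ∀ {e u v} → Joins G e u v → u Fin.< v → lo e ≡ u × hi e ≡ v
  joins-< (inj₁ e≡uv)               u<v = e≡uv
  joins-< {e} (inj₂ (refl , refl)) u<v = contradiction (lo<hi e) (ℕ.<⇒≯ u<v)

  Between : Fin n → Fin n → Pred (Fin n) _
  Between u v w = u Fin.< w × w Fin.< v

  between? : ∀ u v → Decidable (Between u v)
  between? u v w = u Fin.<? w ×-dec w Fin.<? v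

  -- The working form of a noncrossing component partition, free of blocks; `noncrossing⁺` and
  -- `noncrossing⁻` translate.
  ConnectedNC : Spanning → Set
  ConnectedNC S = ∀ {a b c d} → a Fin.< b → b Fin.< c → c Fin.< d →
                  Connected G S a c → Connected G S b d → Connected G S a b

  module _ {S : Spanning} (nc : NoncrossingEdges G S) where

    -- The path from p to q can leave the open interval spanned by e only through an
    -- end of e, as otherwise one of its edges crosses e.
    straddle : ∀ {e p q} → e ∈ S → Between (lo e) (hi e) p → ¬ Between (lo e) (hi e) q → Connected G S p q →
               Connected G S p (lo e)
    straddle {e} e∈S p-in q-out p~q with exit (between? (lo e) (hi e)) p~q p-in q-out
    ... | x , y , p~x , x–y@(f , f∈S , f≡xy) , (l<x , x<h) , y-out with Fin.<-cmp y (lo e) | Fin.<-cmp y (hi e)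
    ...   | Binary.tri≈ _ refl _ | _ = p~x ◅◅ x–y ◅ ε
    ...   | _ | Binary.tri≈ _ refl _ = p~x ◅◅ x–y ◅ connected-sym (edge-connected e∈S)
    ...   | Binary.tri> _ _ l<y | Binary.tri< y<h _ _ = contradiction (l<y , y<h) y-out
    ...   | Binary.tri< y<l _ _ | _ with refl , refl ← joins-< (joins-sym f≡xy) (ℕ.<-trans y<l l<x) =
      contradiction (inj₁ (y<l , l<x , x<h)) (nc f e f∈S e∈S)
    ...   | _ | Binary.tri> _ _ h<y with refl , refl ← joins-< f≡xy (ℕ.<-trans x<h h<y) =
      contradiction (inj₁ (l<x , x<h , h<y)) (nc e f e∈S f∈S)

    -- Apply straddle to the edge by which the path from c to a leaves (b, d).
    noncrossing-connected : ConnectedNC S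
    noncrossing-connected {a} {b} {c} {d} a<b b<c c<d a~c b~d
      with exit (between? b d) (connected-sym a~c) (b<c , c<d) (λ (b<a , _) → ℕ.<⇒≯ a<b b<a)
    ... | x , y , c~x , x–y@(f , f∈S , f≡xy) , (b<x , x<d) , y-out with Fin.<-cmp y b | Fin.<-cmp y d
    ...   | Binary.tri≈ _ refl _ | _ = a~c ◅◅ c~x ◅◅ x–y ◅ ε
    ...   | _ | Binary.tri≈ _ refl _ = a~c ◅◅ c~x ◅◅ x–y ◅ connected-sym b~d
    ...   | Binary.tri> _ _ b<y | Binary.tri< y<d _ _ = contradiction (b<y , y<d) y-out
    -- The edge `f` from `y` to `x` spans `b` but not `d`, so `straddle` along the walk from `b` to
    -- `d` connects `b` to `y`. In the next case `f` spans `d` but not `b`, and the walk is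
    -- reversed.
    ...   | Binary.tri< y<b _ _ | _ with refl , refl ← joins-< (joins-sym f≡xy) (ℕ.<-trans y<b b<x) =
      a~c ◅◅ c~x ◅◅ x–y ◅ connected-sym
        (straddle f∈S (y<b , b<x) (λ (_ , d<x) → ℕ.<⇒≯ x<d d<x) b~d)
    ...   | _ | Binary.tri> _ _ d<y with refl , refl ← joins-< f≡xy (ℕ.<-trans x<d d<y) =
      a~c ◅◅ c~x ◅◅ connected-sym
        (straddle f∈S (x<d , d<y) (λ (x<b , _) → ℕ.<⇒≯ b<x x<b) (connected-sym b~d)) ◅◅ connected-sym b~d

  noncrossing⁺ : ∀ {H} → ConnectedNC H → ¬ CrossingPartition G (π G H)
  noncrossing⁺ nc (_ , _ , B∈ , B′∈ , B≢B′ , a , c , a∈ , c∈ , b , d , b∈ , d∈ , a<b , b<c , c<d)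
    with ∈-π⁻ B∈ | ∈-π⁻ B′∈
  ... | u , refl | v , refl = B≢B′ (component-cong
    (∈-component⁻ a∈ ◅◅ nc a<b b<c c<d (connected-sym (∈-component⁻ a∈) ◅◅ ∈-component⁻ c∈)
                                       (connected-sym (∈-component⁻ b∈) ◅◅ ∈-component⁻ d∈)
                     ◅◅ connected-sym (∈-component⁻ b∈)))

  noncrossing⁻ : ∀ {H} → ¬ CrossingPartition G (π G H) → ConnectedNC H
  noncrossing⁻ {H} nc {a} {b} a<b b<c c<d a~c b~d = decidable-stable (connected? G H a b) λ a≁b →
    nc (_ , _ , component∈π a , component∈π b , a≁b ∘ component-injective ,
        _ , _ , ∈-component⁺ ε , ∈-component⁺ a~c , _ , _ , ∈-component⁺ ε , ∈-component⁺ b~d , a<b , b<c , c<d)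

  crossing-connected : ∀ {H e f} → ConnectedNC H → e ∈ H → f ∈ H → Crosses G e f → Connected G H (lo e) (lo f)
  crossing-connected nc e∈H f∈H (inj₁ (p , q , r)) = nc p q r (edge-connected e∈H) (edge-connected f∈H)
  crossing-connected nc e∈H f∈H (inj₂ (p , q , r)) = connected-sym (nc p q r (edge-connected f∈H) (edge-connected e∈H))

  -- Bonds and the closure operator

  bond⁺ : ∀ {H} → (∀ {e} → Connected G H (lo e) (hi e) → e ∈ H) → IsBond G H
  bond⁺ {H} closed v = ⊆-antisym (p∩q⊆q H _) λ {e} e∈ → x∈p∩q⁺
    (closed (connected-sym (∈-component⁻ (proj₁ (∈-induced⁻ e∈))) ◅◅ ∈-component⁻ (proj₂ (∈-induced⁻ e∈))) , e∈)

  -- Together with `bond⁺` this replaces the componentwise definition of a bond by a condition on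
  -- single edges.
  bond⁻ : ∀ {H e} → IsBond G H → Connected G H (lo e) (hi e) → e ∈ H
  bond⁻ {H} {e} bond lo~hi = proj₁ (x∈p∩q⁻ H _ (subst (e ∈_) (sym (bond (lo e)))
    (∈-induced⁺ (∈-component⁺ ε) (∈-component⁺ lo~hi))))

  -- Closure in the graphic matroid of `G`; the bonds are its flats.
  cl : Spanning → Spanning
  cl S = setOf λ e → connected? G S (lo e) (hi e)

  ∈-cl⁺ : ∀ {S e} → Connected G S (lo e) (hi e) → e ∈ cl S
  ∈-cl⁺ {S} = ∈-setOf⁺ λ e → connected? G S (lo e) (hi e)

  ∈-cl⁻ : ∀ {S e} → e ∈ cl S → Connected G S (lo e) (hi e)
  ∈-cl⁻ {S} = ∈-setOf⁻ λ e → connected? G S (lo e) (hi e)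

  ⊆-cl : ∀ {S} → S ⊆ cl S
  ⊆-cl e∈S = ∈-cl⁺ (edge-connected e∈S)

  cl-connected⁻ : ∀ {S u v} → Connected G (cl S) u v → Connected G S u v
  cl-connected⁻ ε                        = ε
  cl-connected⁻ ((e , e∈cl , e≡uw) ◅ w~v) = joined-connected (∈-cl⁻ e∈cl) e≡uw ◅◅ cl-connected⁻ w~v

  cc-cl : ∀ S → cc G (cl S) ≡ cc G S
  cc-cl S = cc-cong cl-connected⁻ (connected-mono ⊆-cl)

  cl-bond : ∀ S → IsBond G (cl S)
  cl-bond S = bond⁺ (∈-cl⁺ ∘ cl-connected⁻)

  cl-least : ∀ {S H} → IsBond G H → S ⊆ H → cl S ⊆ H
  cl-least bond S⊆H e∈ = bond⁻ bond (connected-mono S⊆H (∈-cl⁻ e∈))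

  cl-mono : ∀ {S T} → S ⊆ T → cl S ⊆ cl T
  cl-mono {T = T} S⊆T = cl-least (cl-bond T) (⊆-cl ∘ S⊆T)

  cl-noncrossing : ∀ {S} → NoncrossingEdges G S → NoncrossingBond G (cl S)
  cl-noncrossing {S} nc = cl-bond S , noncrossing⁺ λ a<b b<c c<d a~c b~d → connected-mono ⊆-cl
    (noncrossing-connected nc a<b b<c c<d (cl-connected⁻ a~c) (cl-connected⁻ b~d))

  -- With no fewer components in `y`, both sets would connect the same vertices, and the bond `x`
  -- would already contain the additional edge of `y`.
  bond-cc-< : ∀ {x y} → IsBond G x → x ⊂ y → cc G y ℕ.< cc G x
  bond-cc-< x-bond (x⊆y , e , e∈y , e∉x) = ℕ.≰⇒> λ cc≤ →
    e∉x (bond⁻ x-bond (cc-coarsen-reflects (connected-mono x⊆y) cc≤ (edge-connected e∈y)))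

  -- Minimal connected induced subgraphs

  connectedContaining? : ∀ e f → Decidable (ConnectedContaining G e f)
  connectedContaining? e f W = e ∈? induced G W ×-dec f ∈? induced G W ×-dec
    map′ (λ conn {u} {v} → conn u v) (λ conn u v → conn {u} {v})
      (Fin.all? λ u → Fin.all? λ v → u ∈? W →-dec v ∈? W →-dec connected? G (induced G W) u v)

  -- Well-founded descent: pass to a strictly smaller vertex set with the property for as long as a
  -- search finds one.
  minimal⊆ : ∀ {e f} W → Acc _⊂_ W → ConnectedContaining G e f W →
             ∃ λ V → V ⊆ W × MinimalConnectedContaining G e f V
  minimal⊆ {e} {f} W (acc rs) W-conn with anySubset? (λ V → V ⊂? W ×-dec connectedContaining? e f V)
  ... | yes (V , V⊂W , V-conn) with minimal⊆ V (rs V⊂W) V-conn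
  ...   | U , U⊆V , U-min = U , ⊆-trans U⊆V (proj₁ V⊂W) , U-min
  minimal⊆ W _ W-conn | no ∄V = W , ⊆-refl , W-conn , λ {V} V-conn V⊆W →
    decidable-stable (V ≟ₛ W) λ V≢W → ∄V (V , ⊆∧≢⇒⊂ V⊆W V≢W , V-conn)

  joined∈induced : ∀ {W e u v} → Joins G e u v → u ∈ W → v ∈ W → e ∈ induced G W
  joined∈induced (inj₁ (refl , refl)) u∈W v∈W = ∈-induced⁺ u∈W v∈W
  joined∈induced (inj₂ (refl , refl)) u∈W v∈W = ∈-induced⁺ v∈W u∈W

  -- Every vertex of the walk is reachable from `w`, so all its edges are induced on the component.
  component-connected : ∀ {H} w {u v} → Connected G H w u → Connected G H u v →
                        Connected G (induced G (component G H w)) u v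
  component-connected w w~u ε = ε
  component-connected w w~u (u–t@(e , e∈H , e≡ut) ◅ t~v) =
    (e , joined∈induced e≡ut (∈-component⁺ w~u) (∈-component⁺ w~t) , e≡ut) ◅ component-connected w w~t t~v
    where w~t = w~u ◅◅ u–t ◅ ε

  component-connectedContaining : ∀ {H e f} → e ∈ H → f ∈ H → Connected G H (lo e) (lo f) →
                                  ConnectedContaining G e f (component G H (lo e))
  component-connectedContaining {H} {e} {f} e∈H f∈H e~f =
    ∈-induced⁺ (∈-component⁺ ε) (∈-component⁺ (edge-connected e∈H)) ,
    ∈-induced⁺ (∈-component⁺ e~f) (∈-component⁺ (e~f ◅◅ edge-connected f∈H)) ,
    λ u∈ v∈ → component-connected (lo e) (∈-component⁻ u∈)
                (connected-sym (∈-component⁻ u∈) ◅◅ ∈-component⁻ v∈)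

  -- Noncrossing components put `e` and `f` into one component. It contains some minimal connected
  -- induced subgraph around both edges, which is `J` by uniqueness.
  J⊆component : ∀ (closed : CrossingClosed G) {H e f} (e×f : Crosses G e f) → ConnectedNC H →
                e ∈ H → f ∈ H → J G closed e×f ⊆ component G H (lo e)
  J⊆component closed {H} {e} {f} e×f nc e∈H f∈H
    with minimal⊆ (component G H (lo e)) (⊂-wellFounded _)
           (component-connectedContaining e∈H f∈H (crossing-connected nc e∈H f∈H e×f))
  ... | V , V⊆ , V-min = subst (_⊆ _) (sym (proj₂ (proj₂ (closed e×f)) V-min)) V⊆

-- Noncrossing NBC sets

module NoncrossingNBCSets {ℓ n} (G : Graph n) {_⊴_ : Rel (Graph.Edge G) ℓ} (⊴-total : IsTotalOrder _≡_ _⊴_) where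
  open Graph G
  open GraphProperties G
  private module ⊴ = IsTotalOrder ⊴-total

  -- Taken relative to all of `G`, so that one predicate serves every bond; `ncnbc-restrict⁺` and
  -- `ncnbc-restrict⁻` compare it with the notion inside a bond.
  NCNBC : Pred Spanning ℓ
  NCNBC = NoncrossingNBC G ⊴-total ⊤

  -- abstract, since unfolding the decision procedure makes with-abstraction intractable
  abstract
    ncnbc? : Decidable NCNBC
    ncnbc? = noncrossingNBC? G ⊴-total ⊤

  ncnbc-mono : ∀ {S T} → S ⊆ T → NCNBC T → NCNBC S
  ncnbc-mono S⊆T ((_ , nbc) , nc) =
    (⊆⊤ , λ (B , broken , B⊆S) → nbc (B , broken , S⊆T ∘ B⊆S)) ,
    λ e f e∈S f∈S → nc e f (S⊆T e∈S) (S⊆T f∈S)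

  -- A cycle in `S` without its least edge is a broken circuit in `S`. The edge `e` is where the
  -- search for a least edge starts.
  ncnbc-acyclic : ∀ {S C} → NCNBC S → IsCycle G ⊤ C → C ⊆ S → ∀ {e} → e ∉ C
  ncnbc-acyclic {C = C} ((_ , nbc) , _) cycle C⊆S e∈C with least ⊴-total (_∈? C) (_ , e∈C)
  ... | min , min∈C , min⊴ =
    nbc (C Subset.- min , (C , min , cycle , min∈C , (λ _ → min⊴) , refl) , C⊆S ∘ p─q⊆p C _)

  ncnbc-bridge : ∀ {S e} → e ∉ S → NCNBC (insert e S) → ¬ Connected G S (lo e) (hi e)
  ncnbc-bridge e∉S N lo~hi with connected⇒cycle e∉S (inj₁ (refl , refl)) lo~hi
  ... | C , f , cycle , C⊆ , f∈C = ncnbc-acyclic N cycle C⊆ f∈C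

  broken-circuit-closes : ∀ {H C e} → IsCycle G ⊤ C → e ∈ C → C Subset.- e ⊆ H → Connected G H (lo e) (hi e)
  broken-circuit-closes cycle e∈C C-e⊆H = cycle-closes (λ f∈C f≢e → C-e⊆H (x∈p∧x≢y⇒x∈p-y f∈C f≢e)) cycle e∈C

  -- A broken circuit inside the empty set would connect the distinct ends of its missing edge
  -- without any edge.
  ncnbc-⊥ : NCNBC ⊥
  ncnbc-⊥ = (⊆⊤ , λ where
      (_ , (C , e , cycle , e∈C , _ , refl) , C-e⊆⊥) →
        contradiction (connected-⊥ (broken-circuit-closes cycle e∈C C-e⊆⊥)) (joins-≢ (inj₁ (refl , refl)))) ,
    λ _ _ e∈⊥ → contradiction e∈⊥ ∉⊥

  -- The count of edges in a forest: by `ncnbc-bridge` each inserted edge unites two components.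
  ncnbc-rank : ∀ S → NCNBC S → ∣ S ∣ ℕ.+ cc G S ≡ n
  ncnbc-rank = insert-induction _ (λ _ → cong₂ ℕ._+_ (∣⊥∣≡0 size) cc-⊥) λ {S} e e∉S ih N → begin
    ∣ insert e S ∣ ℕ.+ cc G (insert e S)  ≡⟨ cong (ℕ._+ cc G (insert e S)) (∣insert∣ e S e∉S) ⟩
    suc (∣ S ∣ ℕ.+ cc G (insert e S))     ≡⟨ ℕ.+-suc ∣ S ∣ _ ⟨
    ∣ S ∣ ℕ.+ suc (cc G (insert e S))     ≡⟨ cong (∣ S ∣ ℕ.+_) (cc-insert (ncnbc-bridge e∉S N)) ⟨
    ∣ S ∣ ℕ.+ cc G S                      ≡⟨ ih (ncnbc-mono (⊆-insert e S) N) ⟩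
    n                                    ∎
    where open ≡-Reasoning

  ncnbc-restrict⁺ : ∀ {H S} → NCNBC S → S ⊆ H → NoncrossingNBC G ⊴-total H S
  ncnbc-restrict⁺ ((_ , nbc) , nc) S⊆H =
    (S⊆H , λ where
      (B , (C , e , (_ , cycle) , broken) , B⊆S) → nbc (B , (C , e , (⊆⊤ , cycle) , broken) , B⊆S)) , nc

  -- A broken circuit of `G` inside `S` connects the ends of its missing edge within `H`. As `H` is
  -- a bond it contains that edge, so the whole cycle lies in `H`.
  ncnbc-restrict⁻ : ∀ {H S} → IsBond G H → NoncrossingNBC G ⊴-total H S → NCNBC S
  ncnbc-restrict⁻ {H} {S} bond ((S⊆H , nbc) , nc) = (⊆⊤ , λ where
      (B , (C , e , cycle , e∈C , e⊴ , refl) , B⊆S) →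
        nbc (B , (C , e , (C⊆H cycle e∈C (S⊆H ∘ B⊆S) , proj₂ cycle) , e∈C , e⊴ , refl) , B⊆S)) , nc
    where
    C⊆H : ∀ {C e} → IsCycle G ⊤ C → e ∈ C → C Subset.- e ⊆ H → C ⊆ H
    C⊆H {e = e} cycle e∈C C-e⊆H {f} f∈C with f Fin.≟ e
    ... | yes refl = bond⁻ bond (broken-circuit-closes cycle e∈C C-e⊆H)
    ... | no f≢e   = C-e⊆H (x∈p∧x≢y⇒x∈p-y f∈C f≢e)

  cl-ncnbc : ∀ {S} → NCNBC S → NoncrossingBond G (cl S)
  cl-ncnbc (_ , nc) = cl-noncrossing nc

  -- This identifies the sets counted by `ν` with those in the theorem. Conversely to the forest
  -- count, the right size gives `S` as many components as `H`, and then `S ⊆ H` forces equal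
  -- connectivity.
  cl≡⇔size : ∀ {H S} → IsBond G H →
             (cl S ≡ H × NCNBC S) ⇔ (NoncrossingNBC G ⊴-total H S × ∣ S ∣ ≡ n ∸ cc G H)
  cl≡⇔size {H} {S} bond = mk⇔ to from
    where
    to : cl S ≡ H × NCNBC S → NoncrossingNBC G ⊴-total H S × ∣ S ∣ ≡ n ∸ cc G H
    to (refl , N) = ncnbc-restrict⁺ N ⊆-cl , (begin
      ∣ S ∣                        ≡⟨ ℕ.m+n∸n≡m ∣ S ∣ (cc G S) ⟨
      ∣ S ∣ ℕ.+ cc G S ∸ cc G S    ≡⟨ cong₂ _∸_ (ncnbc-rank S N) (sym (cc-cl S)) ⟩
      n ∸ cc G (cl S)             ∎)
      where open ≡-Reasoning

    from : NoncrossingNBC G ⊴-total H S × ∣ S ∣ ≡ n ∸ cc G H → cl S ≡ H × NCNBC S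
    from (N@((S⊆H , _) , _) , ∣S∣≡) = ⊆-antisym (cl-least bond S⊆H) (λ e∈H → ∈-cl⁺ (H⇒S (edge-connected e∈H))) , N′
      where
      open ≡-Reasoning
      N′ = ncnbc-restrict⁻ bond N

      cc≡ : cc G S ≡ cc G H
      cc≡ = ℕ.+-cancelˡ-≡ ∣ S ∣ _ _ (begin
        ∣ S ∣ ℕ.+ cc G S             ≡⟨ ncnbc-rank S N′ ⟩
        -- The subtraction is not truncated, since there are at most `n` components.
        n                           ≡⟨ ℕ.m∸n+n≡m (cc≤n H) ⟨
        n ∸ cc G H ℕ.+ cc G H       ≡⟨ cong (ℕ._+ cc G H) ∣S∣≡ ⟨
        ∣ S ∣ ℕ.+ cc G H             ∎)

      H⇒S : ∀ {u v} → Connected G H u v → Connected G S u v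
      H⇒S = cc-coarsen-reflects (connected-mono S⊆H) (ℕ.≤-reflexive cc≡)

  cl-⊥ : cl ⊥ ≡ ⊥
  cl-⊥ = ⊆-antisym (λ e∈ → contradiction (connected-⊥ (∈-cl⁻ e∈)) (joins-≢ (inj₁ (refl , refl))))
                   (λ e∈ → contradiction e∈ ∉⊥)

  -- Ranks of closures

  module _ {ρ} (isRank : NC.IsRankFunction G ρ) where
    open NC.IsRankFunction G isRank

    ρ-cl : ∀ S → NCNBC S → ρ (cl S) ≡ ∣ S ∣
    ρ-cl = insert-induction _ (λ _ → trans (cong ρ cl-⊥) (trans rank-0̂ (sym (∣⊥∣≡0 size)))) λ {S} e e∉S ih N →
      trans (rank-cover (cover e∉S N))
        (trans (cong suc (ih (ncnbc-mono (⊆-insert e S) N))) (sym (∣insert∣ e S e∉S)))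
      where
      -- cc drops by exactly one, which leaves no room for a bond in between.
      cover : ∀ {S e} → e ∉ S → NCNBC (insert e S) → NC.Covers G (cl S) (cl (insert e S))
      cover {S} {e} e∉S N =
        cl-ncnbc (ncnbc-mono (⊆-insert e S) N) , cl-ncnbc N ,
        (cl-mono (⊆-insert e S) , e , ⊆-cl (∈-insert e S) , ncnbc-bridge e∉S N ∘ ∈-cl⁻) ,
        λ (z , (z-bond , _) , x⊂z , z⊂y) → ℕ.<⇒≱ (bond-cc-< z-bond z⊂y) (ℕ.≤-pred (begin
          suc (cc G z)                  ≤⟨ bond-cc-< (cl-bond S) x⊂z ⟩
          cc G (cl S)                   ≡⟨ cc-cl S ⟩
          cc G S                        ≡⟨ cc-insert (ncnbc-bridge e∉S N) ⟩
          suc (cc G (insert e S))       ≡⟨ cong suc (cc-cl (insert e S)) ⟨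
          suc (cc G (cl (insert e S)))  ∎))
        where open ℕ.≤-Reasoning

  -- Inserting the least edge of a noncrossing bond

  module _ (upper : UpperCrossingClosed G _⊴_) {H} (H-ncb : NoncrossingBond G H)
           {e₀} (e₀∈H : e₀ ∈ H) (e₀⊴ : ∀ {e} → e ∈ H → e₀ ⊴ e) where

    -- A crossing would place `J` inside a component of `H`. The edge of `J` strictly below `e₀`
    -- would then belong to the bond `H`, where `e₀` is least.
    least-uncrossed : ∀ {f} → f ∈ H → ¬ Crosses G e₀ f
    least-uncrossed f∈H e₀×f with proj₂ upper e₀×f
    ... | h , h∈J , (h⊴e₀ , h≢e₀) , _ with ∈-induced⁻ h∈J
    ...   | lo∈J , hi∈J = h≢e₀ (⊴.antisym h⊴e₀ (e₀⊴ (bond⁻ (proj₁ H-ncb)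
              (connected-sym (∈-component⁻ (J⊆ lo∈J)) ◅◅ ∈-component⁻ (J⊆ hi∈J)))))
      where J⊆ = J⊆component (proj₁ upper) e₀×f (noncrossing⁻ (proj₂ H-ncb)) e₀∈H f∈H

    -- The inserting half of the involution; the removing half is `ncnbc-mono`.
    insert-least : ∀ {S} → S ⊆ H → NCNBC S → NCNBC (insert e₀ S)
    insert-least {S} S⊆H ((_ , nbc) , nc) = (⊆⊤ , nbc′) , nc′
      where
      nc′ : NoncrossingEdges G (insert e₀ S)
      nc′ e f e∈ f∈ e×f with ∈-insert⁻ e₀ S e∈ | ∈-insert⁻ e₀ S f∈
      ... | inj₁ refl | inj₁ refl = case e×f of λ where
        (inj₁ (lo<lo , _)) → ℕ.<-irrefl refl lo<lo
        (inj₂ (lo<lo , _)) → ℕ.<-irrefl refl lo<lo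
      ... | inj₁ refl | inj₂ f∈S  = least-uncrossed (S⊆H f∈S) e×f
      ... | inj₂ e∈S  | inj₁ refl = least-uncrossed (S⊆H e∈S) (case e×f of λ where
        (inj₁ e×e₀) → inj₂ e×e₀
        (inj₂ e₀×e) → inj₁ e₀×e)
      ... | inj₂ e∈S  | inj₂ f∈S  = nc e f e∈S f∈S e×f

      -- A circuit C whose remainder C - e contains e₀ and lies in H lies in H
      -- entirely, so its least edge e would have to be e₀.
      nbc′ : ¬ ∃ λ B → BrokenCircuit G ⊴-total ⊤ B × B ⊆ insert e₀ S
      nbc′ (B , broken@(C , e , cycle , e∈C , e⊴ , refl) , B⊆) = nbc (B , broken , B⊆S)
        where
        e∈H : e ∈ H
        e∈H = bond⁻ (proj₁ H-ncb) (broken-circuit-closes cycle e∈C λ f∈B → case ∈-insert⁻ e₀ S (B⊆ f∈B) of λ where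
          (inj₁ refl) → e₀∈H
          (inj₂ f∈S)  → S⊆H f∈S)

        B⊆S : B ⊆ S
        B⊆S {f} f∈B with ∈-insert⁻ e₀ S (B⊆ f∈B)
        ... | inj₂ f∈S  = f∈S
        ... | inj₁ refl with refl ← ⊴.antisym (e⊴ e₀ (p─q⊆p C _ f∈B)) (e₀⊴ e∈H) =
          contradiction f∈B (x∉p-x C)

-- Möbius functions

module MöbiusFunction {m} {P : Pred (Subset m) ℓ} (P? : Decidable P) where
  open InclusionPoset P?

  -- Well-founded recursion unfolds here because `μ-step` depends only on the values of its
  -- recursive calls.
  μ-unfold : ∀ x → μ x ≡ μ-step x (λ {y} _ → μ y)
  μ-unfold x = FixPoint.unfold-wfRec ⊂-wellFounded (λ _ → ℤ) μ-step μ-step-ext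
    where
    [⇒]-cong : ∀ {C : Set} (C? : Dec C) {f g : C → ℤ} → (∀ c → f c ≡ g c) → [ C? ⇒ f ] ≡ [ C? ⇒ g ]
    [⇒]-cong (yes c) f≗g = f≗g c
    [⇒]-cong (no _)  f≗g = refl

    μ-step-ext : ∀ x {f g : ∀ {y} → y ⊂ x → ℤ} → (∀ {y} (y⊂x : y ⊂ x) → f y⊂x ≡ g y⊂x) →
                 μ-step x f ≡ μ-step x g
    μ-step-ext x f≗g with does (x ≟ₛ ⊥)
    ... | true  = refl
    ... | false = cong -_ (∑-cong elements λ y → [⇒]-cong (y ⊂? x) f≗g)

  μ-⊥ : μ ⊥ ≡ 1ℤ
  μ-⊥ rewrite μ-unfold ⊥ | dec-true (⊥ {m} ≟ₛ ⊥) refl = refl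

  μ-≢⊥ : ∀ {x} → x ≢ ⊥ → μ x ≡ - ∑ (subsets m) (λ y → (μ y when (y ⊂? x)) when P? y)
  μ-≢⊥ {x} x≢⊥ rewrite μ-unfold x | dec-false (x ≟ₛ ⊥) x≢⊥ = cong -_ (∑-filter P? _ (subsets m))

  -- Splitting the term `y = x` off the vanishing sum over `y ⊆ x` shows that `ν` satisfies the
  -- recursion of `μ`; induction along `_⊂_` does the rest.
  μ-unique : ∀ (ν : Subset m → ℤ) → ν ⊥ ≡ 1ℤ →
             (∀ {x} → P x → x ≢ ⊥ → ∑ (subsets m) (λ y → (ν y when (y ⊆? x)) when P? y) ≡ 0ℤ) →
             ∀ {x} → P x → μ x ≡ ν x
  μ-unique ν ν-⊥ ν-sum {x} = go (⊂-wellFounded x)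
    where
    below : (Subset m → ℤ) → Subset m → Subset m → ℤ
    below f x y = (f y when (y ⊂? x)) when P? y

    split : ∀ {x} → P x → ∀ y → (ν y when (y ⊆? x)) when P? y ≡ below ν x y + ν y when (x ≟ₛ y)
    split {x} px y with x ≟ₛ y
    ... | yes refl = begin
      (ν x when (x ⊆? x)) when P? x     ≡⟨ trans (when-yes (P? x) px) (when-yes (x ⊆? x) id) ⟩
      ν x                               ≡⟨ ℤ.+-identityˡ _ ⟨
      0ℤ + ν x                          ≡⟨ cong (_+ ν x) (trans (when-yes (P? x) px) (when-no (x ⊂? x) (⊂-irref refl))) ⟨
      below ν x x + ν x                 ∎
      where open ≡-Reasoning
    ... | no x≢y = trans
      (when-cong′ (P? y) λ _ →
        when-cong (y ⊆? x) (y ⊂? x) (λ y⊆x → ⊆∧≢⇒⊂ y⊆x (≢-sym x≢y)) proj₁ λ _ → refl)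
      (sym (ℤ.+-identityʳ _))

    go : ∀ {x} → Acc _⊂_ x → P x → μ x ≡ ν x
    go {x} (acc rs) px = cases (x ≟ₛ ⊥)
      where
      open ≡-Reasoning

      cases : Dec (x ≡ ⊥) → μ x ≡ ν x
      cases (yes x≡⊥) = trans (cong μ x≡⊥) (trans μ-⊥ (trans (sym ν-⊥) (cong ν (sym x≡⊥))))
      cases (no x≢⊥)  = begin
        μ x                           ≡⟨ μ-≢⊥ x≢⊥ ⟩
        - ∑ (subsets m) (below μ x)   ≡⟨ cong -_ (∑-cong (subsets m) λ y → when-cong′ (P? y) λ py →
                                           when-cong′ (y ⊂? x) λ y⊂x → go (rs y⊂x) py) ⟩
        - ∑ (subsets m) (below ν x)   ≡⟨ inverseʳ-unique _ _ (begin
          ∑ (subsets m) (below ν x) + ν x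
            ≡⟨ cong (_+_ (∑ (subsets m) (below ν x))) (∑-δ {_≟_ = _≟ₛ_} ν (subsets-! m) (∈-subsets x)) ⟨
          ∑ (subsets m) (below ν x) + ∑ (subsets m) (λ y → ν y when (x ≟ₛ y))
            ≡⟨ ∑-distrib-+ (below ν x) _ (subsets m) ⟨
          ∑ (subsets m) (λ y → below ν x y + ν y when (x ≟ₛ y))
            ≡⟨ ∑-cong (subsets m) (split px) ⟨
          ∑ (subsets m) (λ y → (ν y when (y ⊆? x)) when P? y)
            ≡⟨ ν-sum px x≢⊥ ⟩
          0ℤ                          ∎) ⟨
        ν x                           ∎

-- Summation over the fibres of `c`: after exchanging the sums, only `x = c S` survives, and it
-- satisfies `P`. With `c = cl` this is applied to the Möbius sums, `D` being containment in a bond,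
-- and to the coefficients of `χ`, `D` fixing the exponent.
∑-fibre : ∀ {P : Pred (Subset m) ℓ} {N : Pred (Subset m) ℓ′} {D : Pred (Subset m) b}
          (P? : Decidable P) (N? : Decidable N) (D? : Decidable D) (c : Subset m → Subset m) (w : Subset m → ℤ) →
          (∀ {S} → N S → P (c S)) →
          ∑ (subsets m) (λ x → (∑ (subsets m) (λ S → (w S when N? S) when (c S ≟ₛ x)) when D? x) when P? x) ≡
          ∑ (subsets m) (λ S → (w S when N? S) when D? (c S))
∑-fibre {m = m} P? N? D? c w N⇒P = begin
  ∑ (subsets m) (λ x → (∑ (subsets m) (λ S → w′ S when (c S ≟ₛ x)) when D? x) when P? x)
    ≡⟨ ∑-cong (subsets m) (λ x → trans
         (cong (_when P? x) (sym (∑-when _ (subsets m) (D? x))))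
         (sym (∑-when _ (subsets m) (P? x)))) ⟩
  ∑ (subsets m) (λ x → ∑ (subsets m) (λ S → ((w′ S when (c S ≟ₛ x)) when D? x) when P? x))
    ≡⟨ ∑-swap _ (subsets m) (subsets m) ⟩
  ∑ (subsets m) (λ S → ∑ (subsets m) (λ x → ((w′ S when (c S ≟ₛ x)) when D? x) when P? x))
    ≡⟨ ∑-cong (subsets m) (λ S → ∑-cong (subsets m) λ x → trans
         (cong (_when P? x) (when-comm (D? x) (c S ≟ₛ x)))
         (when-comm (P? x) (c S ≟ₛ x))) ⟩
  ∑ (subsets m) (λ S → ∑ (subsets m) (λ x → ((w′ S when D? x) when P? x) when (c S ≟ₛ x)))
    ≡⟨ ∑-cong (subsets m) (λ S → ∑-δ {_≟_ = _≟ₛ_} _ (subsets-! m) (∈-subsets (c S))) ⟩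
  ∑ (subsets m) (λ S → (w′ S when D? (c S)) when P? (c S))
    ≡⟨ ∑-cong (subsets m) supported ⟩
  ∑ (subsets m) (λ S → w′ S when D? (c S))
    ∎
  where
  open ≡-Reasoning
  w′ : Subset m → ℤ
  w′ S = w S when N? S

  supported : ∀ S → (w′ S when D? (c S)) when P? (c S) ≡ w′ S when D? (c S)
  supported S with N? S
  ... | yes N = when-yes (P? (c S)) (N⇒P N)
  ... | no _  with P? (c S) | D? (c S)
  ...   | yes _ | _     = refl
  ...   | no _  | yes _ = refl
  ...   | no _  | no _  = refl

-- Signed counts and the two formulas

sign : Subset m → ℤ
sign S = -1ℤ ^ ∣ S ∣

module Counting {ℓ n} (G : Graph n) {_⊴_ : Rel (Graph.Edge G) ℓ} (⊴-total : IsTotalOrder _≡_ _⊴_)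
                (upper : UpperCrossingClosed G _⊴_) where
  open Graph G
  open GraphProperties G
  open NoncrossingNBCSets G ⊴-total

  ν : Spanning → ℤ
  ν x = ∑ (subsets size) λ S → (sign S when ncnbc? S) when (cl S ≟ₛ x)

  -- As `S ⊆ cl S`, only the empty set has empty closure.
  ν-⊥ : ν ⊥ ≡ 1ℤ
  ν-⊥ = begin
    ν ⊥                         ≡⟨ ∑-cong (subsets size) (λ S → when-cong (cl S ≟ₛ ⊥) (⊥ ≟ₛ S)
                                     (λ cl≡⊥ → ⊆-antisym (λ e∈⊥ → contradiction e∈⊥ ∉⊥) (λ e∈S → subst (_ ∈_) cl≡⊥ (⊆-cl e∈S)))
                                     (λ { refl → cl-⊥ }) (λ _ → refl)) ⟩
    ∑ (subsets size) (λ S → (sign S when ncnbc? S) when (⊥ ≟ₛ S))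
                                ≡⟨ ∑-δ {_≟_ = _≟ₛ_} _ (subsets-! size) (∈-subsets ⊥) ⟩
    sign (⊥ {size}) when ncnbc? ⊥       ≡⟨ when-yes (ncnbc? ⊥) ncnbc-⊥ ⟩
    sign (⊥ {size})                     ≡⟨ cong (-1ℤ ^_) (∣⊥∣≡0 size) ⟩
    1ℤ                          ∎
    where open ≡-Reasoning

  signed-sum : ∀ {H} → NoncrossingBond G H → H ≢ ⊥ → ∑ (subsets size) (λ S → (sign S when ncnbc? S) when (S ⊆? H)) ≡ 0ℤ
  signed-sum {H} H-ncb H≢⊥ with nonempty? H
  ... | no empty = contradiction (Empty-unique empty) H≢⊥
  ... | yes nonempty with least ⊴-total (_∈? H) nonempty
  ...   | e₀ , e₀∈H , e₀⊴ = ∑-toggle e₀ term cancel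
    where
    term : Spanning → ℤ
    term S = (sign S when ncnbc? S) when (S ⊆? H)

    insert⊆ : ∀ {S} → S ⊆ H → insert e₀ S ⊆ H
    insert⊆ {S} S⊆H f∈ with ∈-insert⁻ e₀ S f∈
    ... | inj₁ refl = e₀∈H
    ... | inj₂ f∈S  = S⊆H f∈S

    cancel : ∀ S → e₀ ∉ S → term S + term (insert e₀ S) ≡ 0ℤ
    cancel S e₀∉S with S ⊆? H
    ... | no S⊈H = trans (ℤ.+-identityˡ _) (when-no (insert e₀ S ⊆? H) λ ⊆H → S⊈H (⊆H ∘ ⊆-insert e₀ S))
    ... | yes S⊆H = trans (cong (_+_ (sign S when ncnbc? S)) (when-yes (insert e₀ S ⊆? H) (insert⊆ S⊆H))) (signs (ncnbc? S))
      where
      signs : (N? : Dec (NCNBC S)) → sign S when N? + sign (insert e₀ S) when ncnbc? (insert e₀ S) ≡ 0ℤ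
      signs (no ¬N) = trans (ℤ.+-identityˡ _) (when-no (ncnbc? (insert e₀ S)) (¬N ∘ ncnbc-mono (⊆-insert e₀ S)))
      signs (yes N) = begin
        sign S + sign (insert e₀ S) when ncnbc? (insert e₀ S)
          ≡⟨ cong (_+_ (sign S)) (when-yes (ncnbc? (insert e₀ S)) (insert-least upper H-ncb e₀∈H e₀⊴ S⊆H N)) ⟩
        sign S + sign (insert e₀ S)   ≡⟨ cong (λ k → sign S + -1ℤ ^ k) (∣insert∣ e₀ S e₀∉S) ⟩
        sign S + -1ℤ * sign S         ≡⟨ cong (_+_ (sign S)) (ℤ.-1*i≡-i (sign S)) ⟩
        sign S + - sign S             ≡⟨ ℤ.+-inverseʳ (sign S) ⟩
        0ℤ                            ∎
        where open ≡-Reasoning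

  μ≡ν : ∀ {x} → NoncrossingBond G x → NC.μ G x ≡ ν x
  μ≡ν = MöbiusFunction.μ-unique (noncrossingBond? G) ν ν-⊥ λ {x} x-ncb x≢⊥ → begin
    ∑ (subsets size) (λ y → (ν y when (y ⊆? x)) when noncrossingBond? G y)
      ≡⟨ ∑-fibre (noncrossingBond? G) ncnbc? (_⊆? x) cl sign cl-ncnbc ⟩
    ∑ (subsets size) (λ S → (sign S when ncnbc? S) when (cl S ⊆? x))
      -- A bond contains `cl S` exactly when it contains `S`.
      ≡⟨ ∑-cong (subsets size) (λ S → when-cong (cl S ⊆? x) (S ⊆? x)
           (λ cl⊆x → cl⊆x ∘ ⊆-cl) (cl-least (proj₁ x-ncb)) (λ _ → refl)) ⟩
    ∑ (subsets size) (λ S → (sign S when ncnbc? S) when (S ⊆? x))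
      ≡⟨ signed-sum x-ncb x≢⊥ ⟩
    0ℤ
      ∎
    where open ≡-Reasoning

  count-ncnbc : ∀ (c : ℤ) k X → c * + ncnbc G ⊴-total k X ≡
                ∑ (subsets size) (λ S → c when (noncrossingNBC? G ⊴-total X S ×-dec ∣ S ∣ ℕ.≟ k))
  count-ncnbc c k X = trans (sym (∑-const c (filter Q? (subsets size)))) (∑-filter Q? _ (subsets size))
    where
    Q? : Decidable (λ S → NoncrossingNBC G ⊴-total X S × ∣ S ∣ ≡ k)
    Q? S = noncrossingNBC? G ⊴-total X S ×-dec ∣ S ∣ ℕ.≟ k

  μ-formula : ∀ H → NoncrossingBond G H → NC.μ G H ≡ -1ℤ ^ (n ∸ cc G H) * + ncnbc G ⊴-total (n ∸ cc G H) H
  μ-formula H H-ncb@(bond , _) = begin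
    NC.μ G H
      ≡⟨ μ≡ν H-ncb ⟩
    ∑ (subsets size) (λ S → (sign S when ncnbc? S) when (cl S ≟ₛ H))
      -- All sets with closure `H` that count have size `k`, so they share one sign.
      ≡⟨ ∑-cong (subsets size) (λ S → trans (when-×-dec (cl S ≟ₛ H) (ncnbc? S))
           (when-cong (cl S ≟ₛ H ×-dec ncnbc? S) (noncrossingNBC? G ⊴-total H S ×-dec ∣ S ∣ ℕ.≟ k)
             (Equivalence.to (cl≡⇔size bond)) (Equivalence.from (cl≡⇔size bond))
             (λ S∈ → cong (-1ℤ ^_) (proj₂ (Equivalence.to (cl≡⇔size bond) S∈))))) ⟩
    ∑ (subsets size) (λ S → -1ℤ ^ k when (noncrossingNBC? G ⊴-total H S ×-dec ∣ S ∣ ℕ.≟ k))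
      ≡⟨ count-ncnbc (-1ℤ ^ k) k H ⟨
    -1ℤ ^ k * + ncnbc G ⊴-total k H
      ∎
    where
    open ≡-Reasoning
    k = n ∸ cc G H

  χ-formula : ∀ (graded : NC.Graded G) j → NC.χ G graded j ≡ ∑ᴸ (upTo (suc size)) (λ k →
              monomial (-1ℤ ^ k * + ncnbc G ⊴-total k ⊤) (+ NC.Graded.rank G graded - + k)) j
  χ-formula graded j = begin
    NC.χ G graded j
      ≡⟨ ∑-filter (noncrossingBond? G) _ (subsets size) ⟩
    ∑ (subsets size) (λ x → (NC.μ G x when (r - + ρ x ℤ.≟ j)) when noncrossingBond? G x)
      ≡⟨ ∑-cong (subsets size) (λ x → when-cong′ (noncrossingBond? G x) λ px → cong (_when (r - + ρ x ℤ.≟ j)) (μ≡ν px)) ⟩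
    ∑ (subsets size) (λ x → (ν x when (r - + ρ x ℤ.≟ j)) when noncrossingBond? G x)
      ≡⟨ ∑-fibre (noncrossingBond? G) ncnbc? (λ x → r - + ρ x ℤ.≟ j) cl sign cl-ncnbc ⟩
    ∑ (subsets size) (λ S → (sign S when ncnbc? S) when (r - + ρ (cl S) ℤ.≟ j))
      ≡⟨ ∑-cong (subsets size) by-size ⟩
    ∑ (subsets size) (λ S → ∑ (upTo (suc size)) λ k →
      (-1ℤ ^ k when (r - + k ℤ.≟ j)) when ncnbc? S when (∣ S ∣ ℕ.≟ k))
      ≡⟨ ∑-swap _ (subsets size) (upTo (suc size)) ⟩
    ∑ (upTo (suc size)) (λ k → ∑ (subsets size) λ S →
      (-1ℤ ^ k when (r - + k ℤ.≟ j)) when ncnbc? S when (∣ S ∣ ℕ.≟ k))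
      ≡⟨ ∑-cong (upTo (suc size)) by-count ⟩
    ∑ (upTo (suc size)) (λ k → (-1ℤ ^ k * + ncnbc G ⊴-total k ⊤) when (r - + k ℤ.≟ j))
      ∎
    where
    open ≡-Reasoning
    open NC.Graded G graded
    r = + rank

    by-size : ∀ S → (sign S when ncnbc? S) when (r - + ρ (cl S) ℤ.≟ j) ≡
              ∑ (upTo (suc size)) (λ k → ((-1ℤ ^ k when (r - + k ℤ.≟ j)) when ncnbc? S) when (∣ S ∣ ℕ.≟ k))
    by-size S = begin
      (sign S when ncnbc? S) when (r - + ρ (cl S) ℤ.≟ j)
        ≡⟨ when-comm (r - + ρ (cl S) ℤ.≟ j) (ncnbc? S) ⟩
      (sign S when (r - + ρ (cl S) ℤ.≟ j)) when ncnbc? S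
        -- `ρ-cl` needs `NCNBC S`, which is why that bracket was moved to the outside.
        ≡⟨ when-cong′ (ncnbc? S) (λ N → cong (λ k → sign S when (r - + k ℤ.≟ j)) (ρ-cl isRankFunction S N)) ⟩
      (sign S when (r - + ∣ S ∣ ℤ.≟ j)) when ncnbc? S
        -- The range ends at `size`, the greatest possible value of `∣ S ∣`, so `k = ∣ S ∣` occurs
        -- in it.
        ≡⟨ ∑-δ {_≟_ = ℕ._≟_} _ (Unique.upTo⁺ (suc size)) (∈-upTo⁺ (ℕ.s≤s (∣p∣≤n S))) ⟨
      _ ∎

    by-count : ∀ k → ∑ (subsets size) (λ S → ((-1ℤ ^ k when (r - + k ℤ.≟ j)) when ncnbc? S) when (∣ S ∣ ℕ.≟ k)) ≡
               (-1ℤ ^ k * + ncnbc G ⊴-total k ⊤) when (r - + k ℤ.≟ j)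
    by-count k = begin
      ∑ (subsets size) (λ S → ((-1ℤ ^ k when (r - + k ℤ.≟ j)) when ncnbc? S) when (∣ S ∣ ℕ.≟ k))
        ≡⟨ ∑-cong (subsets size) (λ S → trans (when-comm (∣ S ∣ ℕ.≟ k) (ncnbc? S))
             (trans (trans (when-×-dec (ncnbc? S) (∣ S ∣ ℕ.≟ k))
                      -- The condition stays the same; only the abstract decision `ncnbc?` is
                      -- exchanged for the one with which `ncnbc` counts.
                      (when-cong (ncnbc? S ×-dec ∣ S ∣ ℕ.≟ k) (noncrossingNBC? G ⊴-total ⊤ S ×-dec ∣ S ∣ ℕ.≟ k)
                        id id (λ _ → refl)))
               (when-comm (noncrossingNBC? G ⊴-total ⊤ S ×-dec ∣ S ∣ ℕ.≟ k) (r - + k ℤ.≟ j)))) ⟩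
      ∑ (subsets size) (λ S → -1ℤ ^ k when (noncrossingNBC? G ⊴-total ⊤ S ×-dec ∣ S ∣ ℕ.≟ k) when (r - + k ℤ.≟ j))
        ≡⟨ ∑-when _ (subsets size) (r - + k ℤ.≟ j) ⟩
      ∑ (subsets size) (λ S → -1ℤ ^ k when (noncrossingNBC? G ⊴-total ⊤ S ×-dec ∣ S ∣ ℕ.≟ k)) when (r - + k ℤ.≟ j)
        ≡⟨ cong (_when (r - + k ℤ.≟ j)) (count-ncnbc (-1ℤ ^ k) k ⊤) ⟨
      (-1ℤ ^ k * + ncnbc G ⊴-total k ⊤) when (r - + k ℤ.≟ j) ∎

theorem3p5 : ∀ {ℓ : Level} {n : ℕ} (G : Graph n) (_⊴_ : Rel (Graph.Edge G) ℓ)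
  (⊴-total : IsTotalOrder _≡_ _⊴_) → UpperCrossingClosed G _⊴_ →
  (∀ (H : Graph.Spanning G) → NoncrossingBond G H →
    NC.μ G H ≡ -1ℤ ^ (n ∸ cc G H) * + ncnbc G ⊴-total (n ∸ cc G H) H)
  × (∀ (graded : NC.Graded G) →
    NC.χ G graded ≗ ∑ᴸ (upTo (suc (Graph.size G))) (λ k →
      monomial (-1ℤ ^ k * + ncnbc G ⊴-total k ⊤) (+ NC.Graded.rank G graded - + k)))
theorem3p5 G _⊴_ ⊴-total upper = μ-formula , χ-formula
  where open Counting G ⊴-total upper
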